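{- Let $p,q\ge1$, $J\subseteq[p-1]$, $K\subseteq[q-1]$ and $R\subseteq[p+q-1]$. For $\zeta\in\mathfrak{S}^{(p,q)}$ define $r_\zeta\colon\mathcal{Q}_p\times\mathcal{Q}_q\to\mathcal{Q}_{p+q}$ by $r_\zeta(J',K')=\mathrm{Des}\big((\zeta_{J'}\times\zeta_{K'})\cdot\zeta^{ -1}\big)$. Then the coefficient of $M_{R,p+q}$ in the product $M_{J,p}\cdot M_{K,q}$ equals the number of $\zeta\in\mathfrak{S}^{(p,q)}$ such that the set $\{(J',K')\in\mathcal{Q}_p\times\mathcal{Q}_q: r_\zeta(J',K')\subseteq R\}$ has a greatest element with respect to componentwise inclusion and this greatest element is $(J,K)$.
   Context: $\mathcal{Q}_n$ denotes the set of subsets of $[n-1]$ ordered by inclusion. Permutations in one-line notation, product is composition. $\mathrm{Des}(x)=\{i:x_i>x_{i+1}\}$. For $x\in\mathfrak{S}_p,y\in\mathfrak{S}_q$, $x\times y\in\mathfrak{S}_{p+q}$ has $(x\times y)(i)=x_i$ ($i\le p$), $(x\times y)(p+j)=p+y_j$. $\mathfrak{S}^{(p,q)}=\{\zeta\in\mathfrak{S}_{p+q}:\zeta_1<\cdots<\zeta_p,\zeta_{p+1}<\cdots<\zeta_{p+q}\}$. For $J=\{p_1<\cdots<p_k\}\subseteq[n-1]$, $\zeta_J=(n{ - }p_1{+}1,\ldots,n,\ n{ - }p_2{+}1,\ldots,n{ - }p_1,\ldots,1,\ldots,n{ - }p_k)\in\mathfrak{S}_n$, $\zeta_\emptyset=1_n$.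 For $J=\{j_1<\cdots<j_{k-1}\}\subseteq[n-1]$ with composition $\alpha=(j_1,j_2-j_1,\ldots,n-j_{k-1})$, $M_{J,n}=\sum_{i_1<\cdots<i_k}x_{i_1}^{\alpha_1}\cdots x_{i_k}^{\alpha_k}$ is the monomial quasi-symmetric function (commuting variables $x_1,x_2,\ldots$); products are products of formal power series. -}

module Defs where

open import Data.Bool.Base using (Bool; true; false; if_then_else_; _∧_)
open import Data.Fin.Base as Fin using (Fin; zero; suc; toℕ; inject₁; _↑ˡ_; _↑ʳ_)
import Data.Fin.Properties as Fin
open import Data.Fin.Permutation as Perm using (Permutation′; _⟨$⟩ʳ_; _∘ₚ_)
open import Data.Fin.Subset using (Subset; inside; outside; _⊆_)
open import Data.Fin.Subset.Properties using (_⊆?_; anySubset?)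
open import Data.Integer.Base as ℤ using (ℤ; 0ℤ; 1ℤ)
import Data.Integer.Properties as ℤ
open import Data.List.Base as List using (List; []; _∷_; _++_; length; upTo; allFin)
import Data.List.Properties as List
open import Data.List.Relation.Unary.All using (All; []; _∷_)
open import Data.List.Relation.Unary.Any using (Any; here)
import Data.List.Relation.Unary.Any.Properties as Any
open import Data.List.Relation.Unary.AllPairs using ([]; _∷_)
open import Data.List.Membership.Propositional.Properties using (∈-allFin)
open import Data.List.Relation.Unary.Unique.Propositional.Properties using (allFin⁺)
open import Data.List.Relation.Unary.Unique.Setoid using (Unique)
open import Data.List.Relation.Unary.Unique.Setoid.Properties using (cartesianProductWith⁺)
open import Data.Nat.Base as ℕ using (ℕ; zero; suc; pred; _+_; _∸_; _≤_; _<_)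
open import Data.Nat.ListAction using (sum)
import Data.Nat.Properties as ℕ
open import Data.Product.Base using (∃; _×_; _,_)
open import Data.Sum.Algebra using (⊎-comm)
open import Data.Sum.Function.Propositional using (_⊎-↔_)
open import Data.Vec.Base as Vec using (Vec; []; _∷_; _∷ʳ_; updateAt)
import Data.Vec.Properties as Vec
open import Function.Base using (_∘_)
open import Function.Construct.Composition using (_↔-∘_)
open import Function.Construct.Identity using (↔-id)
open import Function.Construct.Symmetry using (↔-sym)
open import Level using (0ℓ)
open import Relation.Binary.Bundles using (Setoid)
open import Relation.Binary.PropositionalEquality
open import Relation.Nullary.Decidable using (Dec; does; map′; ¬?; _×-dec_; _→-dec_; decidable-stable)
open import Relation.Unary using (Pred; Decidable)

private
  variable
    m n p q : ℕ

-- The subsets of [n-1]: the index i : Fin (n-1) stands for the integer i+1.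
𝒬 : ℕ → Set
𝒬 n = Subset (pred n)

subsets : ∀ m → List (Subset m)
subsets zero    = [] ∷ []
subsets (suc m) = List.cartesianProductWith _∷_ (outside ∷ inside ∷ []) (subsets m)

elementsFrom : ℕ → Subset m → List ℕ
elementsFrom i []            = []
elementsFrom i (inside  ∷ J) = i ∷ elementsFrom (suc i) J
elementsFrom i (outside ∷ J) = elementsFrom (suc i) J

elements : 𝒬 n → List ℕ
elements = elementsFrom 1

-- gaps n j₀ (j₁ ∷ … ∷ jₖ) = j₁ - j₀ , j₂ - j₁ , … , n - jₖ
gaps : ℕ → ℕ → List ℕ → List ℕ
gaps n a []       = (n ∸ a) ∷ []
gaps n a (j ∷ js) = (j ∸ a) ∷ gaps n j js

composition : ∀ n → 𝒬 n → List ℕ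
composition zero    J = []
composition (suc n) J = gaps (suc n) 0 (elements {suc n} J)

gaps-positive : ∀ n a i (J : Subset m) → a < i → i + m ≤ n →
                All (0 <_) (gaps n a (elementsFrom i J))
gaps-positive n a i [] a<i i≤n =
  ℕ.m<n⇒0<n∸m (ℕ.<-≤-trans a<i (ℕ.≤-trans (ℕ.m≤m+n i 0) i≤n)) ∷ []
gaps-positive {suc m} n a i (inside ∷ J) a<i i≤n =
  ℕ.m<n⇒0<n∸m a<i ∷
  gaps-positive n i (suc i) J ℕ.≤-refl (subst (_≤ n) (ℕ.+-suc i m) i≤n)
gaps-positive {suc m} n a i (outside ∷ J) a<i i≤n =
  gaps-positive n a (suc i) J (ℕ.m<n⇒m<1+n a<i) (subst (_≤ n) (ℕ.+-suc i m) i≤n)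

gaps-sum : ∀ n a i (J : Subset m) → a < i → i + m ≤ n →
           sum (gaps n a (elementsFrom i J)) ≡ n ∸ a
gaps-sum n a i [] a<i i≤n = ℕ.+-identityʳ (n ∸ a)
gaps-sum {suc m} n a i (inside ∷ J) a<i i≤n = begin
  (i ∸ a) + sum (gaps n i (elementsFrom (suc i) J))
    ≡⟨ cong ((i ∸ a) ℕ.+_) (gaps-sum n i (suc i) J ℕ.≤-refl (subst (_≤ n) (ℕ.+-suc i m) i≤n)) ⟩
  (i ∸ a) + (n ∸ i)   ≡⟨ ℕ.+-comm (i ∸ a) (n ∸ i) ⟩
  (n ∸ i) + (i ∸ a)   ≡⟨ ℕ.+-∸-assoc (n ∸ i) (ℕ.<⇒≤ a<i) ⟨
  (n ∸ i) + i ∸ a     ≡⟨ cong (_∸ a) (ℕ.m∸n+n≡m (ℕ.≤-trans (ℕ.m≤m+n i (suc m)) i≤n)) ⟩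
  n ∸ a               ∎
  where open ≡-Reasoning
gaps-sum {suc m} n a i (outside ∷ J) a<i i≤n =
  gaps-sum n a (suc i) J (ℕ.m<n⇒m<1+n a<i) (subst (_≤ n) (ℕ.+-suc i m) i≤n)

composition-positive : ∀ n (J : 𝒬 n) → All (0 <_) (composition n J)
composition-positive zero    J = []
composition-positive (suc n) J = gaps-positive (suc n) 0 1 J ℕ.≤-refl ℕ.≤-refl

composition-sum : ∀ n (J : 𝒬 n) → sum (composition n J) ≡ n
composition-sum zero    J = refl
composition-sum (suc n) J = gaps-sum (suc n) 0 1 J ℕ.≤-refl ℕ.≤-refl

infixl 7 _·_
_·_ : Permutation′ n → Permutation′ n → Permutation′ n
x · y = y ∘ₚ x   -- _∘ₚ_ applies its left argument first

infixr 6 _⊗_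
_⊗_ : Permutation′ p → Permutation′ q → Permutation′ (p + q)
_⊗_ {p} {q} x y = ↔-sym (Fin.+↔⊎ {p} {q}) ↔-∘ ((x ⊎-↔ y) ↔-∘ Fin.+↔⊎ {p} {q})

Des : Permutation′ n → 𝒬 n
Des {zero}  x = []
Des {suc n} x = Vec.tabulate λ i → does ((x ⟨$⟩ʳ suc i) Fin.<? (x ⟨$⟩ʳ inject₁ i))

-- In one-line notation: m+1 , … , m+a followed by the word of π.
stack : ∀ a {m} → Permutation′ m → Permutation′ (a + m)
stack a {m} π =
  Perm.cast-id (ℕ.+-comm m a) ↔-∘
    (↔-sym (Fin.+↔⊎ {m} {a}) ↔-∘
      (⊎-comm (Fin a) (Fin m) ↔-∘
        ((↔-id (Fin a) ⊎-↔ π) ↔-∘ Fin.+↔⊎ {a} {m})))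

blocks : (α : List ℕ) → Permutation′ (sum α)
blocks []      = Perm.id
blocks (a ∷ α) = stack a (blocks α)

-- The blocks of ζ_J have the lengths p₁ , p₂ - p₁ , … , n - pₖ of the
-- composition of n attached to J; ζ-oneLine below recovers the displayed word.
ζ[_] : 𝒬 n → Permutation′ n
ζ[_] {n} J = subst Permutation′ (composition-sum n J) (blocks (composition n J))

oneLine : Permutation′ n → List ℕ
oneLine π = List.tabulate (λ i → suc (toℕ (π ⟨$⟩ʳ i)))

-- lo+1 , … , hi
interval : ℕ → ℕ → List ℕ
interval lo hi = List.tabulate {n = hi ∸ lo} (λ i → suc (lo + toℕ i))

ζ-word : ℕ → ℕ → List ℕ → List ℕ
ζ-word n a []       = interval 0 (n ∸ a)
ζ-word n a (p ∷ ps) = interval (n ∸ p) (n ∸ a) ++ ζ-word n p ps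

tabulate-+ : ∀ {A : Set} a {m} (f : Fin (a + m) → A) →
             List.tabulate f ≡ List.tabulate (λ i → f (i ↑ˡ m)) ++ List.tabulate (λ i → f (a ↑ʳ i))
tabulate-+ zero    f = refl
tabulate-+ (suc a) f = cong (f zero ∷_) (tabulate-+ a (f ∘ suc))

oneLine-stack : ∀ a (π : Permutation′ m) →
                oneLine (stack a π) ≡ List.tabulate {n = a} (λ i → suc (m + toℕ i)) ++ oneLine π
oneLine-stack {m} a π = trans (tabulate-+ a (λ i → ℕ.suc (toℕ (stack a π ⟨$⟩ʳ i))))
  (cong₂ _++_ (List.tabulate-cong low) (List.tabulate-cong high))
  where
  low : (i : Fin a) → ℕ.suc (toℕ (stack a π ⟨$⟩ʳ (i ↑ˡ m))) ≡ ℕ.suc (m + toℕ i)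
  low i rewrite Fin.splitAt-↑ˡ a i m = cong suc (trans (Fin.toℕ-cast _ (m ↑ʳ i)) (Fin.toℕ-↑ʳ m i))
  high : (i : Fin m) → ℕ.suc (toℕ (stack a π ⟨$⟩ʳ (a ↑ʳ i))) ≡ ℕ.suc (toℕ (π ⟨$⟩ʳ i))
  high i rewrite Fin.splitAt-↑ʳ a m i =
    cong suc (trans (Fin.toℕ-cast _ ((π ⟨$⟩ʳ i) ↑ˡ a)) (Fin.toℕ-↑ˡ (π ⟨$⟩ʳ i) a))

oneLine-subst : (eq : m ≡ n) (π : Permutation′ m) → oneLine (subst Permutation′ eq π) ≡ oneLine π
oneLine-subst refl π = refl

∸-∸-cancel : ∀ {a p n} → a ≤ p → p ≤ n → (n ∸ a) ∸ (n ∸ p) ≡ p ∸ a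
∸-∸-cancel {a} {p} {n} a≤p p≤n = begin
  (n ∸ a) ∸ (n ∸ p)  ≡⟨ ℕ.∸-+-assoc n a (n ∸ p) ⟩
  n ∸ (a + (n ∸ p))  ≡⟨ cong (n ∸_) (ℕ.+-comm a (n ∸ p)) ⟩
  n ∸ ((n ∸ p) + a)  ≡⟨ ℕ.∸-+-assoc n (n ∸ p) a ⟨
  n ∸ (n ∸ p) ∸ a    ≡⟨ cong (_∸ a) (ℕ.m∸[m∸n]≡n p≤n) ⟩
  p ∸ a              ∎
  where open ≡-Reasoning

oneLine-blocks : ∀ n a i (J : Subset m) → a < i → i + m ≤ n →
                 oneLine (blocks (gaps n a (elementsFrom i J))) ≡ ζ-word n a (elementsFrom i J)
oneLine-blocks n a i [] a<i i≤n =
  trans (oneLine-stack (n ∸ a) Perm.id) (List.++-identityʳ _)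
oneLine-blocks {suc m} n a i (inside ∷ J) a<i i≤n =
  trans (oneLine-stack (i ∸ a) (blocks (gaps n i (elementsFrom (suc i) J))))
    (cong₂ _++_
      (cong₂ (λ s l → List.tabulate {n = l} (λ k → suc (s + toℕ k)))
        (gaps-sum n i (suc i) J ℕ.≤-refl i≤n′)
        (sym (∸-∸-cancel (ℕ.<⇒≤ a<i) (ℕ.≤-trans (ℕ.m≤m+n i (suc m)) i≤n))))
      (oneLine-blocks n i (suc i) J ℕ.≤-refl i≤n′))
  where i≤n′ = subst (_≤ n) (ℕ.+-suc i m) i≤n
oneLine-blocks {suc m} n a i (outside ∷ J) a<i i≤n =
  oneLine-blocks n a (suc i) J (ℕ.m<n⇒m<1+n a<i) (subst (_≤ n) (ℕ.+-suc i m) i≤n)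

ζ-oneLine : ∀ n (J : 𝒬 n) → oneLine (ζ[_] {n} J) ≡ ζ-word n 0 (elements {n} J)
ζ-oneLine zero    [] = refl
ζ-oneLine (suc n) J  = trans (oneLine-subst (composition-sum (suc n) J) _)
  (oneLine-blocks (suc n) 0 1 J ℕ.≤-refl ℕ.≤-refl)

Shuffle : ∀ p q → Pred (Permutation′ (p + q)) 0ℓ
Shuffle p q ζ =
  (∀ (i j : Fin p) → i Fin.< j → (ζ ⟨$⟩ʳ (i ↑ˡ q)) Fin.< (ζ ⟨$⟩ʳ (j ↑ˡ q))) ×
  (∀ (i j : Fin q) → i Fin.< j → (ζ ⟨$⟩ʳ (p ↑ʳ i)) Fin.< (ζ ⟨$⟩ʳ (p ↑ʳ j)))

shuffle? : ∀ p q → Decidable (Shuffle p q)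
shuffle? p q ζ =
  Fin.all? (λ i → Fin.all? λ j → (i Fin.<? j) →-dec (_ Fin.<? _)) ×-dec
  Fin.all? (λ i → Fin.all? λ j → (i Fin.<? j) →-dec (_ Fin.<? _))

r : ∀ {p q} → Permutation′ (p + q) → 𝒬 p → 𝒬 q → 𝒬 (p + q)
r {p} {q} ζ J′ K′ = Des ((ζ[_] {p} J′ ⊗ ζ[_] {q} K′) · Perm.flip ζ)

-- (J , K) is the greatest element of {(J′ , K′) : r ζ J′ K′ ⊆ R}.
IsGreatest : ∀ {p q} → Permutation′ (p + q) → 𝒬 (p + q) → 𝒬 p → 𝒬 q → Set
IsGreatest {p} {q} ζ R J K =
  r {p} {q} ζ J K ⊆ R ×
  (∀ (J′ : 𝒬 p) (K′ : 𝒬 q) → r {p} {q} ζ J′ K′ ⊆ R → J′ ⊆ J × K′ ⊆ K)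

allSubsets? : {P : Pred (Subset m) 0ℓ} → Decidable P → Dec (∀ J → P J)
allSubsets? P? = map′ (λ ¬∃ J → decidable-stable (P? J) (λ ¬p → ¬∃ (J , ¬p)))
                      (λ ∀P (J , ¬p) → ¬p (∀P J))
                      (¬? (anySubset? (¬? ∘ P?)))

isGreatest? : ∀ {p q} ζ R J K → Dec (IsGreatest {p} {q} ζ R J K)
isGreatest? {p} {q} ζ R J K =
  (r {p} {q} ζ J K ⊆? R) ×-dec
  allSubsets? λ J′ → allSubsets? λ K′ →
    (r {p} {q} ζ J′ K′ ⊆? R) →-dec ((J′ ⊆? J) ×-dec (K′ ⊆? K))

-- Every permutation occurs exactly once up to Perm._≈_ (permutations-complete,
-- permutations-unique).
permutations : ∀ n → List (Permutation′ n)
permutations zero    = Perm.id ∷ []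
permutations (suc n) = List.cartesianProductWith (Perm.insert zero) (allFin (suc n)) (permutations n)

permSetoid : ℕ → Setoid 0ℓ 0ℓ
permSetoid n = record
  { Carrier = Permutation′ n ; _≈_ = Perm._≈_
  ; isEquivalence = record
    { refl = λ _ → refl ; sym = λ e i → sym (e i) ; trans = λ e f i → trans (e i) (f i) } }

insert-cong : ∀ (j : Fin (suc n)) (π ρ : Permutation′ n) → π Perm.≈ ρ →
              Perm.insert zero j π Perm.≈ Perm.insert zero j ρ
insert-cong j π ρ e zero    = refl
insert-cong j π ρ e (suc k) = cong (Fin.punchIn j) (e k)

permutations-complete : ∀ n (π : Permutation′ n) → Any (π Perm.≈_) (permutations n)
permutations-complete zero    π = here λ ()
permutations-complete (suc n) π =
  Any.cartesianProductWith⁺ (Perm.insert zero)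
    (λ { refl e i → trans (sym (Perm.insert-remove zero π i))
           (insert-cong (π ⟨$⟩ʳ zero) (Perm.remove zero π) _ e i) })
    (∈-allFin (π ⟨$⟩ʳ zero))
    (permutations-complete n (Perm.remove zero π))

permutations-unique : ∀ n → Unique (permSetoid n) (permutations n)
permutations-unique zero    = [] ∷ []
permutations-unique (suc n) =
  cartesianProductWith⁺ (setoid (Fin (suc n))) (permSetoid n) (permSetoid (suc n)) (Perm.insert zero)
    (λ {w} {x} {y} {z} → injective w x y z) (allFin⁺ (suc n)) (permutations-unique n)
  where
  injective : ∀ w x (y z : Permutation′ n) → Perm.insert zero w y Perm.≈ Perm.insert zero x z →
              w ≡ x × y Perm.≈ z
  injective w x y z e with refl ← e zero =
    refl , λ i → Fin.punchIn-injective w _ _ (e (suc i))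

numberOfMatchingShuffles : ∀ {p q} → 𝒬 p → 𝒬 q → 𝒬 (p + q) → ℕ
numberOfMatchingShuffles {p} {q} J K R =
  length (List.filter (λ ζ → shuffle? p q ζ ×-dec isGreatest? {p} {q} ζ R J K) (permutations (p + q)))

-- Formal power series over ℤ in x₁ , x₂ , … : the vector e : Vec ℕ m stands for the
-- monomial x₁^e₁ ⋯ xₘ^eₘ, so e and e ∷ʳ 0 are the same monomial.
record Series : Set where
  field
    coeff  : ∀ {m} → Vec ℕ m → ℤ
    stable : ∀ {m} (e : Vec ℕ m) → coeff (e ∷ʳ 0) ≡ coeff e

open Series public

infix 4 _≋_
_≋_ : Series → Series → Set
f ≋ g = ∀ {m} (e : Vec ℕ m) → coeff f e ≡ coeff g e

Σℤ : List ℤ → ℤ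
Σℤ = List.foldr ℤ._+_ 0ℤ

𝟘 : Series
𝟘 = record { coeff = λ _ → 0ℤ ; stable = λ _ → refl }

infixl 6 _⊕_
_⊕_ : Series → Series → Series
f ⊕ g = record
  { coeff  = λ e → coeff f e ℤ.+ coeff g e
  ; stable = λ e → cong₂ ℤ._+_ (stable f e) (stable g e)
  }

infixr 7 _•_
_•_ : ℤ → Series → Series
c • f = record
  { coeff  = λ e → c ℤ.* coeff f e
  ; stable = λ e → cong (c ℤ.*_) (stable f e)
  }

-- All pairs of monomials with product x^e.
factorisations : Vec ℕ m → List (Vec ℕ m × Vec ℕ m)
factorisations []      = ([] , []) ∷ []
factorisations (n ∷ e) =
  List.cartesianProductWith (λ i (a , b) → (i ∷ a) , ((n ∸ i) ∷ b)) (upTo (suc n)) (factorisations e)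

snoc₀ : Vec ℕ m × Vec ℕ m → Vec ℕ (suc m) × Vec ℕ (suc m)
snoc₀ (a , b) = (a ∷ʳ 0) , (b ∷ʳ 0)

map-cartesianProductWith : ∀ {A B B′ C C′ : Set} (f : A → B → C) (f′ : A → B′ → C′)
  (g : B → B′) (h : C → C′) → (∀ x y → f′ x (g y) ≡ h (f x y)) → ∀ xs ys →
  List.cartesianProductWith f′ xs (List.map g ys) ≡ List.map h (List.cartesianProductWith f xs ys)
map-cartesianProductWith f f′ g h eq []       ys = refl
map-cartesianProductWith f f′ g h eq (x ∷ xs) ys = trans
  (cong₂ _++_
    (trans (sym (List.map-∘ ys)) (trans (List.map-cong (eq x) ys) (List.map-∘ ys)))
    (map-cartesianProductWith f f′ g h eq xs ys))
  (sym (List.map-++ h (List.map (f x) ys) _))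

factorisations-∷ʳ : (e : Vec ℕ m) →
                    factorisations (e ∷ʳ 0) ≡ List.map snoc₀ (factorisations e)
factorisations-∷ʳ []      = refl
factorisations-∷ʳ (n ∷ e) = trans
  (cong (List.cartesianProductWith _ (upTo (suc n))) (factorisations-∷ʳ e))
  (map-cartesianProductWith _ _ snoc₀ snoc₀ (λ _ _ → refl) (upTo (suc n)) (factorisations e))

infixl 7 _⊛_
_⊛_ : Series → Series → Series
f ⊛ g = record
  { coeff  = λ e → Σℤ (List.map (λ (a , b) → coeff f a ℤ.* coeff g b) (factorisations e))
  ; stable = λ e → cong Σℤ (trans
      (cong (List.map _) (factorisations-∷ʳ e))
      (trans (sym (List.map-∘ (factorisations e)))
             (List.map-cong (λ (a , b) → cong₂ ℤ._*_ (stable f a) (stable g b)) (factorisations e))))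
  }

-- All sequences i₁ < ⋯ < iₖ of indices of the variables x₁ , … , xₘ.
increasing : ∀ k m → List (Vec (Fin m) k)
increasing zero    m       = [] ∷ []
increasing (suc k) zero    = []
increasing (suc k) (suc m) =
  List.map (λ is → zero ∷ Vec.map suc is) (increasing k m) ++ List.map (Vec.map suc) (increasing (suc k) m)

-- x_{i₁}^{α₁} ⋯ x_{iₖ}^{αₖ}
monomial : (α : List ℕ) → Vec (Fin m) (length α) → Vec ℕ m
monomial []      []       = Vec.replicate _ 0
monomial (a ∷ α) (i ∷ is) = updateAt (monomial α is) i (a ℕ.+_)

infix 4 _≟ᵐ_
_≟ᵐ_ : (e e′ : Vec ℕ m) → Dec (e ≡ e′)
_≟ᵐ_ = Vec.≡-dec ℕ._≟_

-- The coefficient of x^e in Σ_{i₁ < ⋯ < iₖ} x_{i₁}^{α₁} ⋯ x_{iₖ}^{αₖ}. As the parts of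
-- α are positive, only sequences with iₖ ≤ m contribute to a monomial in x₁ , … , xₘ.
coeffM : List ℕ → Vec ℕ m → ℤ
coeffM {m} α e =
  Σℤ (List.map (λ is → if does (monomial α is ≟ᵐ e) then 1ℤ else 0ℤ) (increasing (length α) m))

δ : Bool → ℤ → ℤ
δ b z = if b then z else 0ℤ

Σℤ-++ : ∀ xs ys → Σℤ (xs ++ ys) ≡ Σℤ xs ℤ.+ Σℤ ys
Σℤ-++ []       ys = sym (ℤ.+-identityˡ (Σℤ ys))
Σℤ-++ (x ∷ xs) ys = trans (cong (λ z → x ℤ.+ z) (Σℤ-++ xs ys)) (sym (ℤ.+-assoc x (Σℤ xs) (Σℤ ys)))

Σℤ-δ : ∀ {A : Set} b (f : A → Bool) xs →
       Σℤ (List.map (λ x → δ (b ∧ f x) 1ℤ) xs) ≡ δ b (Σℤ (List.map (λ x → δ (f x) 1ℤ) xs))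
Σℤ-δ true  f xs       = refl
Σℤ-δ false f []       = refl
Σℤ-δ false f (x ∷ xs) = trans (ℤ.+-identityˡ _) (Σℤ-δ false f xs)

monomial-suc : (α : List ℕ) (is : Vec (Fin m) (length α)) →
               monomial α (Vec.map suc is) ≡ 0 ∷ monomial α is
monomial-suc []      []       = refl
monomial-suc (a ∷ α) (i ∷ is) = cong (λ e → updateAt e (suc i) (a ℕ.+_)) (monomial-suc α is)

Σ-shift : ∀ {A : Set} (g : A → Vec ℕ (suc m)) (h : A → Vec ℕ m) b n (e : Vec ℕ m) →
          (∀ x → g x ≡ b ∷ h x) → ∀ xs →
          Σℤ (List.map (λ x → δ (does (g x ≟ᵐ (n ∷ e))) 1ℤ) xs) ≡
          δ (does (b ℕ.≟ n)) (Σℤ (List.map (λ x → δ (does (h x ≟ᵐ e)) 1ℤ) xs))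
Σ-shift g h b n e eq xs = trans
  (cong Σℤ (List.map-cong (λ x → cong (λ v → δ (does (v ≟ᵐ (n ∷ e))) 1ℤ) (eq x)) xs))
  (Σℤ-δ (does (b ℕ.≟ n)) (λ x → does (h x ≟ᵐ e)) xs)

coeffM-[] : ∀ n (e : Vec ℕ m) → coeffM [] (n ∷ e) ≡ δ (does (0 ℕ.≟ n)) (coeffM [] e)
coeffM-[] {m} n e = Σℤ-δ (does (0 ℕ.≟ n)) (λ is → does (monomial [] is ≟ᵐ e)) (increasing 0 m)

coeffM-∷ : ∀ a α n (e : Vec ℕ m) → coeffM (a ∷ α) (n ∷ e) ≡
           δ (does (a + 0 ℕ.≟ n)) (coeffM α e) ℤ.+ δ (does (0 ℕ.≟ n)) (coeffM (a ∷ α) e)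
coeffM-∷ {m} a α n e = begin
  Σℤ (List.map F (List.map G (increasing k m) ++ List.map H (increasing (suc k) m)))
    ≡⟨ cong Σℤ (List.map-++ F (List.map G (increasing k m)) _) ⟩
  Σℤ (List.map F (List.map G (increasing k m)) ++ List.map F (List.map H (increasing (suc k) m)))
    ≡⟨ Σℤ-++ (List.map F (List.map G (increasing k m))) _ ⟩
  Σℤ (List.map F (List.map G (increasing k m))) ℤ.+ Σℤ (List.map F (List.map H (increasing (suc k) m)))
    ≡⟨ cong₂ (λ x y → Σℤ x ℤ.+ Σℤ y) (List.map-∘ (increasing k m)) (List.map-∘ (increasing (suc k) m)) ⟨
  Σℤ (List.map (F ∘ G) (increasing k m)) ℤ.+ Σℤ (List.map (F ∘ H) (increasing (suc k) m))
    ≡⟨ cong₂ ℤ._+_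
         (Σ-shift (monomial (a ∷ α) ∘ G) (monomial α) (a + 0) n e
           (λ is → cong (λ v → updateAt v zero (a ℕ.+_)) (monomial-suc α is)) (increasing k m))
         (Σ-shift (monomial (a ∷ α) ∘ H) (monomial (a ∷ α)) 0 n e
           (monomial-suc (a ∷ α)) (increasing (suc k) m)) ⟩
  δ (does (a + 0 ℕ.≟ n)) (coeffM α e) ℤ.+ δ (does (0 ℕ.≟ n)) (coeffM (a ∷ α) e) ∎
  where
  open ≡-Reasoning
  k = length α
  F : Vec (Fin (suc m)) (suc k) → ℤ
  F is = δ (does (monomial (a ∷ α) is ≟ᵐ (n ∷ e))) 1ℤ
  G : Vec (Fin m) k → Vec (Fin (suc m)) (suc k)
  G is = zero ∷ Vec.map suc is
  H : Vec (Fin m) (suc k) → Vec (Fin (suc m)) (suc k)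
  H = Vec.map suc

coeffM-stable : ∀ α → All (0 <_) α → (e : Vec ℕ m) → coeffM α (e ∷ʳ 0) ≡ coeffM α e
coeffM-stable []          _           []      = refl
coeffM-stable (suc a ∷ α) _           []      = coeffM-∷ (suc a) α 0 []
coeffM-stable []          []          (n ∷ e) = begin
  coeffM [] (n ∷ (e ∷ʳ 0))                    ≡⟨ coeffM-[] n (e ∷ʳ 0) ⟩
  δ (does (0 ℕ.≟ n)) (coeffM [] (e ∷ʳ 0))     ≡⟨ cong (δ (does (0 ℕ.≟ n))) (coeffM-stable [] [] e) ⟩
  δ (does (0 ℕ.≟ n)) (coeffM [] e)            ≡⟨ coeffM-[] n e ⟨
  coeffM [] (n ∷ e)                           ∎
  where open ≡-Reasoning
coeffM-stable (a ∷ α)     (0<a ∷ 0<α) (n ∷ e) = begin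
  coeffM (a ∷ α) (n ∷ (e ∷ʳ 0))
    ≡⟨ coeffM-∷ a α n (e ∷ʳ 0) ⟩
  δ (does (a + 0 ℕ.≟ n)) (coeffM α (e ∷ʳ 0)) ℤ.+ δ (does (0 ℕ.≟ n)) (coeffM (a ∷ α) (e ∷ʳ 0))
    ≡⟨ cong₂ (λ x y → δ (does (a + 0 ℕ.≟ n)) x ℤ.+ δ (does (0 ℕ.≟ n)) y)
             (coeffM-stable α 0<α e) (coeffM-stable (a ∷ α) (0<a ∷ 0<α) e) ⟩
  δ (does (a + 0 ℕ.≟ n)) (coeffM α e) ℤ.+ δ (does (0 ℕ.≟ n)) (coeffM (a ∷ α) e)
    ≡⟨ coeffM-∷ a α n e ⟨
  coeffM (a ∷ α) (n ∷ e)  ∎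
  where open ≡-Reasoning

M : ∀ n → 𝒬 n → Series
M n J = record
  { coeff  = coeffM (composition n J)
  ; stable = coeffM-stable (composition n J) (composition-positive n J)
  }

combination : ∀ n → (𝒬 n → ℤ) → Series
combination n d = List.foldr _⊕_ 𝟘 (List.map (λ R → d R • M n R) (subsets (pred n)))

-- "The coefficient of M_{R,n} in f is c": f is a ℤ-linear combination of the M_{S,n},
-- S ∈ 𝒬 n, and M_{R,n} has coefficient c in every such combination.
record IsCoefficientOfM (n : ℕ) (R : 𝒬 n) (f : Series) (c : ℤ) : Set where
  field
    expansion : ∃ λ (d : 𝒬 n → ℤ) → f ≋ combination n d
    unique    : (d : 𝒬 n → ℤ) → f ≋ combination n d → d R ≡ c

{-# OPTIONS --safe #-}

-- A (p,q)-shuffle ζ is a word in p left and q right letters, telling which positions are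
-- the values of ζ on {1,…,p}. Reading (ζ_J × ζ_K) · ζ⁻¹ along this word, two adjacent left
-- (right) letters form a descent iff the corresponding element lies in J (in K), left
-- followed by right is always an ascent, and right followed by left always a descent.
-- Cut the word at the elements of R. Then {(J′ , K′) : r_ζ(J′ , K′) ⊆ R} is nonempty iff
-- in each piece all left letters precede all right letters, and its greatest element then
-- records which consecutive left (right) letters lie in different pieces. So the ζ to be
-- counted are the ways of writing the composition γ of R as a + b with a , b ≥ 0 such that
-- deleting zeros from a and b leaves the compositions of J and K: this is the coefficient
-- of x^γ, hence of M_R, in M_J M_K.

module Submission where

open import Defs
open import Data.Bool.Base as Bool using (Bool; true; false; if_then_else_; _∧_; _xor_; not; b≤b; f≤t)
import Data.Bool.Properties as Bool
open import Data.Empty using (⊥)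
open import Data.Fin.Base as Fin using (Fin; zero; suc; toℕ; inject₁; _↑ˡ_; _↑ʳ_; splitAt; join)
import Data.Fin.Properties as Fin
open import Data.Fin.Permutation as Perm using (Permutation′; _⟨$⟩ʳ_; _⟨$⟩ˡ_)
open import Data.Fin.Subset using (Subset; inside; outside; _⊆_)
open import Data.Fin.Subset.Properties using (drop-∷-⊆; out⊆; s⊆s; ⊆-antisym)
open import Data.Integer.Base as ℤ using (ℤ; 0ℤ; 1ℤ; +_)
import Data.Integer.Properties as ℤ
open import Algebra.Properties.CommutativeSemigroup ℤ.+-commutativeSemigroup using (interchange)
open import Data.List.Base as List using (List; []; _∷_; _++_; upTo; length; replicate)
import Data.List.Properties as List
open import Data.List.Membership.Propositional using (_∈_; find; lose)
open import Data.List.Membership.Propositional.Properties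
  using (∈-map⁺; ∈-map⁻; ∈-++⁺ˡ; ∈-++⁺ʳ; ∈-++⁻; ∈-filter⁺; ∈-filter⁻; ∈-lookup)
open import Data.List.Relation.Unary.All as All using (All; []; _∷_)
open import Data.List.Relation.Unary.Any as Any using (Any; here)
import Data.List.Relation.Unary.Any.Properties as Any
open import Data.List.Relation.Unary.AllPairs using ([]; _∷_)
open import Data.List.Relation.Unary.Unique.Propositional using () renaming (Unique to Unique≡)
import Data.List.Relation.Unary.Unique.Propositional.Properties as Unique≡
open import Data.List.Relation.Unary.Unique.Setoid using (Unique)
import Data.List.Relation.Unary.Unique.Setoid.Properties as Unique
open import Data.Nat.Base as ℕ using (ℕ; zero; suc; _+_; _∸_; _≤_; _<_; s≤s; z≤n)
open import Data.Nat.ListAction using (sum)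
import Data.Nat.Properties as ℕ
open import Data.Product.Base using (∃; _×_; _,_; proj₁; proj₂)
open import Data.Sum.Base as Sum using (_⊎_; inj₁; inj₂; [_,_]′)
open import Data.Unit.Base using (⊤; tt)
open import Data.Vec.Base as Vec using (Vec; []; _∷_; lookup; tabulate; here)
import Data.Vec.Properties as Vec
import Data.Vec.Relation.Unary.All as VecAll
open import Data.Vec.Relation.Unary.All using ([]; _∷_)
import Data.Vec.Relation.Unary.All.Properties as VecAll
open import Function.Base using (_∘_; id)
open import Level using (0ℓ)
open import Relation.Binary.Bundles using (Setoid)
open import Relation.Binary.PropositionalEquality
open import Relation.Nullary.Decidable using (Dec; does; yes; no; dec-true; dec-false; _×-dec_)
open import Relation.Nullary.Negation using (¬_; contradiction)
open import Relation.Unary using (Pred; Decidable)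

private
  variable
    m n p q : ℕ
    X Y Z : Set

-- Sums over lists

∑ : List X → (X → ℤ) → ℤ
∑ xs f = Σℤ (List.map f xs)

infix 4 _≟ᵇ_
_≟ᵇ_ : ℕ → ℕ → Bool
m ≟ᵇ n = does (m ℕ.≟ n)

∑-cong : {f g : X → ℤ} (xs : List X) → (∀ x → f x ≡ g x) → ∑ xs f ≡ ∑ xs g
∑-cong xs eq = cong Σℤ (List.map-cong eq xs)

∑-++ : (xs ys : List X) (f : X → ℤ) → ∑ (xs ++ ys) f ≡ ∑ xs f ℤ.+ ∑ ys f
∑-++ xs ys f = trans (cong Σℤ (List.map-++ f xs ys)) (Σℤ-++ (List.map f xs) (List.map f ys))

∑-map : (g : X → Y) (xs : List X) (f : Y → ℤ) → ∑ (List.map g xs) f ≡ ∑ xs (f ∘ g)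
∑-map g xs f = cong Σℤ (sym (List.map-∘ xs))

∑-0 : (xs : List X) → ∑ xs (λ _ → 0ℤ) ≡ 0ℤ
∑-0 []       = refl
∑-0 (x ∷ xs) = trans (ℤ.+-identityˡ _) (∑-0 xs)

∑-+ : (xs : List X) (f g : X → ℤ) → ∑ xs (λ x → f x ℤ.+ g x) ≡ ∑ xs f ℤ.+ ∑ xs g
∑-+ []       f g = refl
∑-+ (x ∷ xs) f g = trans (cong (λ z → (f x ℤ.+ g x) ℤ.+ z) (∑-+ xs f g)) (interchange (f x) (g x) _ _)

∑-swap : (xs : List X) (ys : List Y) (f : X → Y → ℤ) →
         ∑ xs (λ x → ∑ ys (f x)) ≡ ∑ ys (λ y → ∑ xs (λ x → f x y))
∑-swap []       ys f = sym (∑-0 ys)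
∑-swap (x ∷ xs) ys f = trans (cong (λ z → ∑ ys (f x) ℤ.+ z) (∑-swap xs ys f)) (sym (∑-+ ys (f x) _))

∑-δ : ∀ b (xs : List X) (f : X → ℤ) → ∑ xs (δ b ∘ f) ≡ δ b (∑ xs f)
∑-δ true  xs f = refl
∑-δ false xs f = ∑-0 xs

∑-*ˡ : ∀ c (xs : List X) (f : X → ℤ) → c ℤ.* ∑ xs f ≡ ∑ xs (λ x → c ℤ.* f x)
∑-*ˡ c []       f = ℤ.*-zeroʳ c
∑-*ˡ c (x ∷ xs) f = trans (ℤ.*-distribˡ-+ c (f x) _) (cong (λ z → c ℤ.* f x ℤ.+ z) (∑-*ˡ c xs f))

∑-*ʳ : ∀ c (xs : List X) (f : X → ℤ) → ∑ xs f ℤ.* c ≡ ∑ xs (λ x → f x ℤ.* c)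
∑-*ʳ c []       f = refl
∑-*ʳ c (x ∷ xs) f = trans (ℤ.*-distribʳ-+ c (f x) _) (cong (λ z → f x ℤ.* c ℤ.+ z) (∑-*ʳ c xs f))

∑-*-∑ : (xs : List X) (ys : List Y) (f : X → ℤ) (g : Y → ℤ) →
        ∑ xs f ℤ.* ∑ ys g ≡ ∑ xs (λ x → ∑ ys (λ y → f x ℤ.* g y))
∑-*-∑ xs ys f g = trans (∑-*ʳ (∑ ys g) xs f) (∑-cong xs (λ x → ∑-*ˡ (f x) ys g))

∑-cartesianProductWith : (f : X → Y → Z) (xs : List X) (ys : List Y) (g : Z → ℤ) →
  ∑ (List.cartesianProductWith f xs ys) g ≡ ∑ xs (λ x → ∑ ys (g ∘ f x))
∑-cartesianProductWith f []       ys g = refl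
∑-cartesianProductWith f (x ∷ xs) ys g = trans
  (∑-++ (List.map (f x) ys) _ g)
  (cong₂ ℤ._+_ (∑-map (f x) ys g) (∑-cartesianProductWith f xs ys g))

∑-upTo-suc : ∀ n (f : ℕ → ℤ) → ∑ (upTo (suc n)) f ≡ f 0 ℤ.+ ∑ (upTo n) (f ∘ suc)
∑-upTo-suc n f = cong (λ z → f 0 ℤ.+ z) (trans
  (cong (λ is → ∑ is f) (sym (List.map-upTo suc n))) (∑-map suc (upTo n) f))

∑-upTo-point : ∀ n x (g : ℕ → ℤ) →
  ∑ (upTo n) (λ i → δ (x ≟ᵇ i) (g i)) ≡ δ (does (x ℕ.<? n)) (g x)
∑-upTo-point zero    x       g = refl
∑-upTo-point (suc n) zero    g =
  trans (∑-upTo-suc n (λ i → δ (0 ≟ᵇ i) (g i)))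
    (trans (cong (λ z → g 0 ℤ.+ z) (∑-0 (upTo n))) (ℤ.+-identityʳ (g 0)))
∑-upTo-point (suc n) (suc x) g =
  trans (∑-upTo-suc n (λ i → δ (suc x ≟ᵇ i) (g i)))
    (trans (ℤ.+-identityˡ _) (∑-upTo-point n x (g ∘ suc)))

δ-* : ∀ b c y z → δ b y ℤ.* δ c z ≡ δ b (δ c (y ℤ.* z))
δ-* true  true  y z = refl
δ-* true  false y z = ℤ.*-zeroʳ y
δ-* false c     y z = refl

δ-0 : ∀ b → δ b 0ℤ ≡ 0ℤ
δ-0 true  = refl
δ-0 false = refl

-- Subtraction is truncated, so for `x > n` the test `y ≟ᵇ n ∸ x` would wrongly accept `y = 0`; the
-- guard `x < suc n` excludes this.
δ-≟-∸ : ∀ x y n z → δ (does (x ℕ.<? suc n)) (δ (y ≟ᵇ n ∸ x) z) ≡ δ (x + y ≟ᵇ n) z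
δ-≟-∸ zero    y n       z = refl
δ-≟-∸ (suc x) y zero    z = refl
δ-≟-∸ (suc x) y (suc n) z = δ-≟-∸ x y n z

-- The coefficients of the product M_α M_β

-- The possible exponents x of the first variable in a monomial of M_α, each with the
-- composition α′ governing the remaining variables.
peel : List ℕ → List (ℕ × List ℕ)
peel []      = (0 , []) ∷ []
peel (x ∷ α) = (x , α) ∷ (0 , x ∷ α) ∷ []

coeffM-peel : ∀ α i (e : Vec ℕ m) →
              coeffM α (i ∷ e) ≡ ∑ (peel α) (λ (x , α′) → δ (x ≟ᵇ i) (coeffM α′ e))
coeffM-peel []      i e = trans (coeffM-[] i e) (sym (ℤ.+-identityʳ _))
coeffM-peel (x ∷ α) i e = trans (coeffM-∷ x α i e)
  (cong₂ ℤ._+_ (cong (λ y → δ (y ≟ᵇ i) (coeffM α e)) (ℕ.+-identityʳ x)) (sym (ℤ.+-identityʳ _)))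

productCoeff : List ℕ → List ℕ → Vec ℕ m → ℤ
productCoeff α β e = ∑ (factorisations e) (λ (a , b) → coeffM α a ℤ.* coeffM β b)

-- The first variable is peeled off both factors. Once the sum over its exponent `i` in the left
-- factor has been moved inside, `i` is forced to be `x`, and the condition on the right factor
-- becomes `x + y ≟ᵇ n`.
productCoeff-∷ : ∀ α β n (e : Vec ℕ m) → productCoeff α β (n ∷ e) ≡
  ∑ (peel α) λ (x , α′) → ∑ (peel β) λ (y , β′) → δ (x + y ≟ᵇ n) (productCoeff α′ β′ e)
productCoeff-∷ α β n e = begin
  productCoeff α β (n ∷ e)
    ≡⟨ ∑-cartesianProductWith _ is fs _ ⟩
  ∑ is (λ i → ∑ fs λ (a , b) → coeffM α (i ∷ a) ℤ.* coeffM β (n ∸ i ∷ b))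
    ≡⟨ ∑-cong is (λ i → ∑-cong fs λ (a , b) → trans
         (cong₂ ℤ._*_ (coeffM-peel α i a) (coeffM-peel β (n ∸ i) b))
         (trans (∑-*-∑ xs ys _ _)
           (∑-cong xs λ (x , α′) → ∑-cong ys λ (y , β′) → δ-* (x ≟ᵇ i) (y ≟ᵇ n ∸ i) _ _))) ⟩
  ∑ is (λ i → ∑ fs λ ab → ∑ xs λ xα → ∑ ys λ yβ → term i ab xα yβ)
    ≡⟨ ∑-cong is (λ i → ∑-swap fs xs _) ⟩
  ∑ is (λ i → ∑ xs λ xα → ∑ fs λ ab → ∑ ys λ yβ → term i ab xα yβ)
    ≡⟨ ∑-swap is xs _ ⟩
  ∑ xs (λ xα → ∑ is λ i → ∑ fs λ ab → ∑ ys λ yβ → term i ab xα yβ)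
    ≡⟨ ∑-cong xs (λ xα → trans (∑-cong is (λ i → ∑-swap fs ys _)) (∑-swap is ys _)) ⟩
  ∑ xs (λ xα → ∑ ys λ yβ → ∑ is λ i → ∑ fs λ ab → term i ab xα yβ)
    ≡⟨ ∑-cong xs (λ (x , α′) → ∑-cong ys λ (y , β′) → collect x y α′ β′) ⟩
  ∑ xs (λ (x , α′) → ∑ ys λ (y , β′) → δ (x + y ≟ᵇ n) (productCoeff α′ β′ e)) ∎
  where
  open ≡-Reasoning
  is = upTo (suc n)
  fs = factorisations e
  xs = peel α
  ys = peel β
  term : ℕ → Vec ℕ _ × Vec ℕ _ → ℕ × List ℕ → ℕ × List ℕ → ℤ
  term i (a , b) (x , α′) (y , β′) = δ (x ≟ᵇ i) (δ (y ≟ᵇ n ∸ i) (coeffM α′ a ℤ.* coeffM β′ b))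
  collect : ∀ x y α′ β′ → ∑ is (λ i → ∑ fs λ ab → term i ab (x , α′) (y , β′)) ≡
            δ (x + y ≟ᵇ n) (productCoeff α′ β′ e)
  collect x y α′ β′ = begin
    ∑ is (λ i → ∑ fs λ ab → term i ab (x , α′) (y , β′))
      ≡⟨ ∑-cong is (λ i → trans (∑-δ (x ≟ᵇ i) fs _) (cong (δ (x ≟ᵇ i)) (∑-δ (y ≟ᵇ n ∸ i) fs _))) ⟩
    ∑ is (λ i → δ (x ≟ᵇ i) (δ (y ≟ᵇ n ∸ i) (productCoeff α′ β′ e)))
      ≡⟨ ∑-upTo-point (suc n) x _ ⟩
    δ (does (x ℕ.<? suc n)) (δ (y ≟ᵇ n ∸ x) (productCoeff α′ β′ e))
      ≡⟨ δ-≟-∸ x y n _ ⟩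
    δ (x + y ≟ᵇ n) (productCoeff α′ β′ e) ∎

-- Counting words by their block bits

data Letter : Set where
  left right : Letter

-- J ⊆ [p-1] is encoded by the bits of true ∷ J: bit i tells whether the i-th left letter
-- starts a new block of J; similarly for K and R. leftOK c j r says that a left letter
-- with bit j may stand after the letter c at a position with bit r, when (J , K) is the
-- greatest pair for R: j must tell whether this letter and the previous left letter lie
-- in different pieces, and "right, left" needs a cut. As R starts with a cut, the letter
-- before the first one may be taken to be right.
leftOK rightOK : Letter → Bool → Bool → Bool
leftOK  left  j r = not (j xor r)
leftOK  right j r = j ∧ r
rightOK left  k r = k
rightOK right k r = not (k xor r)

-- The number of words, read from left to right after the letter `c`, in which every letter passes
-- `leftOK` or `rightOK`. Each letter consumes a bit of `R` and a bit of `J` or `K`, and all three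
-- lists must be used up.
count : Letter → List Bool → List Bool → List Bool → ℤ
countLeft countRight : Letter → List Bool → List Bool → Bool → List Bool → ℤ
count c J       K       (r ∷ R) = countLeft c J K r R ℤ.+ countRight c J K r R
count c []      []      []      = 1ℤ
count c []      (_ ∷ _) []      = 0ℤ
count c (_ ∷ _) _       []      = 0ℤ
countLeft  c []      K r R = 0ℤ
countLeft  c (j ∷ J) K r R = δ (leftOK c j r) (count left J K R)
countRight c J []      r R = 0ℤ
countRight c J (k ∷ K) r R = δ (rightOK c k r) (count right J K R)

-- Each part contributes `true` for the first element of its block and `false` for the others. The
-- composition of `J` thus yields the encoding `true ∷ J`.
starts : List ℕ → List Bool
starts []      = []
starts (a ∷ α) = true ∷ replicate (ℕ.pred a) false ++ starts α

-- If c = right, the next left letter is separated from the previous one by a right letter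
-- and so can never carry the bit false.
count-deadˡ : ∀ J K R → count right (false ∷ J) K R ≡ 0ℤ
count-deadˡ J K       []      = refl
count-deadˡ J []      (r ∷ R) = refl
count-deadˡ J (k ∷ K) (r ∷ R) rewrite count-deadˡ J K R =
  trans (ℤ.+-identityˡ _) (δ-0 (rightOK right k r))

-- The next right letter will stand directly behind a left one, where `rightOK left` demands the bit
-- `true`.
count-deadʳ : ∀ J K R → count left J (false ∷ K) R ≡ 0ℤ
count-deadʳ []      K []      = refl
count-deadʳ (j ∷ J) K []      = refl
count-deadʳ []      K (r ∷ R) = refl
count-deadʳ (j ∷ J) K (r ∷ R) rewrite count-deadʳ J K R =
  trans (ℤ.+-identityʳ _) (δ-0 (leftOK left j r))

-- Each nonempty list here begins with `true`, and all four conditions hold when the bits are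
-- `true`. So at the start of a piece the count does not depend on the letter before it.
count-boundary : ∀ α β γ → count left (starts α) (starts β) (starts γ) ≡
                           count right (starts α) (starts β) (starts γ)
count-boundary []      []      []      = refl
count-boundary []      (b ∷ β) []      = refl
count-boundary (a ∷ α) β       []      = refl
count-boundary []      []      (c ∷ γ) = refl
count-boundary []      (b ∷ β) (c ∷ γ) = refl
count-boundary (a ∷ α) []      (c ∷ γ) = refl
count-boundary (a ∷ α) (b ∷ β) (c ∷ γ) = refl

Positive : List ℕ → Set
Positive = All (0 <_)

-- After a right letter, a left one needs a cut, so the `n` positions left in the piece take right
-- letters only. They must exhaust the current block of `K` exactly: a new block cannot start
-- without a cut, and a pending `false` cannot survive one.
count-right-block : ∀ α b β n γ →
  count right (starts α) (replicate b false ++ starts β) (replicate n false ++ starts γ) ≡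
  δ (b ≟ᵇ n) (count right (starts α) (starts β) (starts γ))
count-right-block α       zero    β       zero    γ       = refl
count-right-block []      zero    []      (suc n) γ       = refl
count-right-block []      zero    (x ∷ β) (suc n) γ       = refl
count-right-block (a ∷ α) zero    []      (suc n) γ       = refl
count-right-block (a ∷ α) zero    (x ∷ β) (suc n) γ       = refl
count-right-block []      (suc b) β       zero    []      = refl
count-right-block (a ∷ α) (suc b) β       zero    []      = refl
count-right-block []      (suc b) β       zero    (c ∷ γ) = refl
count-right-block (a ∷ α) (suc b) β       zero    (c ∷ γ) =
  trans (ℤ.+-identityʳ _)
    (count-deadʳ (replicate (ℕ.pred a) false ++ starts α) _ (replicate (ℕ.pred c) false ++ starts γ))
count-right-block []      (suc b) β       (suc n) γ       =
  trans (ℤ.+-identityˡ _) (count-right-block [] b β n γ)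
count-right-block (a ∷ α) (suc b) β       (suc n) γ       =
  trans (ℤ.+-identityˡ _) (count-right-block (a ∷ α) b β n γ)

-- By `count-deadˡ` the `a` pending bits `false` must be used before any right letter. Then the
-- piece either ends or is filled by one whole block of right letters; these are the two entries of
-- `peel β`.
count-left-block : ∀ a α β n γ → Positive β →
  count left (replicate a false ++ starts α) (starts β) (replicate n false ++ starts γ) ≡
  ∑ (peel β) λ (y , β′) → δ (a + y ≟ᵇ n) (count right (starts α) (starts β′) (starts γ))
count-left-block zero α [] zero γ 0<β = trans (count-boundary α [] γ) (sym (ℤ.+-identityʳ _))
count-left-block zero α (suc y ∷ β) zero γ (s≤s _ ∷ _) =
  trans (count-boundary α (suc y ∷ β) γ) (sym (trans (ℤ.+-identityˡ _) (ℤ.+-identityʳ _)))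
count-left-block zero []      []          (suc n) γ 0<β = refl
count-left-block zero (x ∷ α) []          (suc n) γ 0<β = refl
count-left-block zero []      (suc y ∷ β) (suc n) γ (s≤s _ ∷ _) =
  trans (ℤ.+-identityˡ _) (trans (count-right-block [] y β n γ) (sym (ℤ.+-identityʳ _)))
count-left-block zero (x ∷ α) (suc y ∷ β) (suc n) γ (s≤s _ ∷ _) =
  trans (ℤ.+-identityˡ _) (trans (count-right-block (x ∷ α) y β n γ) (sym (ℤ.+-identityʳ _)))
count-left-block (suc a) α []      zero    []      0<β = refl
count-left-block (suc a) α []      zero    (c ∷ γ) 0<β = refl
count-left-block (suc a) α (y ∷ β) zero    []      0<β = refl
count-left-block (suc a) α (y ∷ β) zero    (c ∷ γ) 0<β =
  trans (ℤ.+-identityˡ _)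
    (count-deadˡ _ (replicate (ℕ.pred y) false ++ starts β) (replicate (ℕ.pred c) false ++ starts γ))
count-left-block (suc a) α []      (suc n) γ       0<β =
  trans (ℤ.+-identityʳ _) (count-left-block a α [] n γ 0<β)
count-left-block (suc a) α (y ∷ β) (suc n) γ       0<β =
  trans
    (cong₂ ℤ._+_ (count-left-block a α (y ∷ β) n γ 0<β)
      (count-deadˡ _ (replicate (ℕ.pred y) false ++ starts β) (replicate n false ++ starts γ)))
    (ℤ.+-identityʳ _)

-- The same recursion as `productCoeff-∷`: a piece consists of at most one left block followed by at
-- most one right block, of lengths `x` and `y`, with zero for an absent block.
count-starts-∷ : ∀ α β n γ → Positive α → Positive β →
  count right (starts α) (starts β) (starts (suc n ∷ γ)) ≡
  ∑ (peel α) λ (x , α′) → ∑ (peel β) λ (y , β′) →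
    δ (x + y ≟ᵇ suc n) (count right (starts α′) (starts β′) (starts γ))
count-starts-∷ []          []          n γ 0<α 0<β = refl
count-starts-∷ []          (suc y ∷ β) n γ 0<α 0<β@(s≤s _ ∷ _) = trans (ℤ.+-identityˡ _)
  (trans (count-right-block [] y β n γ) (sym (trans (ℤ.+-identityʳ _) (ℤ.+-identityʳ _))))
count-starts-∷ (suc x ∷ α) []          n γ (s≤s _ ∷ _) 0<β =
  cong (ℤ._+ 0ℤ) (count-left-block x α [] n γ 0<β)
count-starts-∷ (suc x ∷ α) (suc y ∷ β) n γ (s≤s _ ∷ _) 0<β@(s≤s _ ∷ _) = cong₂ ℤ._+_
  (count-left-block x α (suc y ∷ β) n γ 0<β)
  (trans (count-right-block (suc x ∷ α) y β n γ)
    (sym (trans (ℤ.+-identityʳ _) (ℤ.+-identityʳ _))))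

peel-positive : ∀ α → Positive α → All (λ (_ , α′) → Positive α′) (peel α)
peel-positive []      []          = [] ∷ []
peel-positive (x ∷ α) (0<x ∷ 0<α) = 0<α ∷ (0<x ∷ 0<α) ∷ []

∑-cong-All : {P : X → Set} {f g : X → ℤ} {xs : List X} → All P xs →
             (∀ {x} → P x → f x ≡ g x) → ∑ xs f ≡ ∑ xs g
∑-cong-All []        eq = refl
∑-cong-All (px ∷ ps) eq = cong₂ ℤ._+_ (eq px) (∑-cong-All ps eq)

-- Since the parts are positive, `x + y` vanishes only for the choice that removes no part from
-- either composition.
productCoeff-0∷ : ∀ α β (e : Vec ℕ m) → Positive α → Positive β →
                  productCoeff α β (0 ∷ e) ≡ productCoeff α β e
productCoeff-0∷ α β e 0<α 0<β = trans (productCoeff-∷ α β 0 e) (simplify α β 0<α 0<β)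
  where
  simplify : ∀ α β → Positive α → Positive β →
    (∑ (peel α) λ (x , α′) → ∑ (peel β) λ (y , β′) → δ (x + y ≟ᵇ 0) (productCoeff α′ β′ e)) ≡
    productCoeff α β e
  simplify []          []          _ _ = trans (ℤ.+-identityʳ _) (ℤ.+-identityʳ _)
  simplify []          (suc y ∷ β) _ (s≤s _ ∷ _) =
    trans (ℤ.+-identityʳ _) (trans (ℤ.+-identityˡ _) (ℤ.+-identityʳ _))
  simplify (suc x ∷ α) []          (s≤s _ ∷ _) _ =
    trans (ℤ.+-identityˡ _) (trans (ℤ.+-identityʳ _) (ℤ.+-identityʳ _))
  simplify (suc x ∷ α) (suc y ∷ β) (s≤s _ ∷ _) (s≤s _ ∷ _) = trans (ℤ.+-identityˡ _)
    (trans (ℤ.+-identityʳ _) (trans (ℤ.+-identityˡ _) (ℤ.+-identityʳ _)))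

-- Quasi-symmetry in concrete form: the coefficients of `x^e` in the `M_γ` and in their products
-- depend on `e` only through its nonzero exponents in order.
flatten : Vec ℕ m → List ℕ
flatten []          = []
flatten (zero  ∷ e) = flatten e
flatten (suc n ∷ e) = suc n ∷ flatten e

productCoeff-count : ∀ α β (e : Vec ℕ m) → Positive α → Positive β →
  productCoeff α β e ≡ count right (starts α) (starts β) (starts (flatten e))
productCoeff-count []      []      []      0<α 0<β = refl
productCoeff-count []      (y ∷ β) []      0<α 0<β = refl
productCoeff-count (x ∷ α) β       []      0<α 0<β = refl
productCoeff-count α       β       (zero  ∷ e) 0<α 0<β =
  trans (productCoeff-0∷ α β e 0<α 0<β) (productCoeff-count α β e 0<α 0<β)
productCoeff-count α       β       (suc n ∷ e) 0<α 0<β = begin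
  productCoeff α β (suc n ∷ e)
    ≡⟨ productCoeff-∷ α β (suc n) e ⟩
  ∑ (peel α) (λ (x , α′) → ∑ (peel β) λ (y , β′) → δ (x + y ≟ᵇ suc n) (productCoeff α′ β′ e))
    ≡⟨ ∑-cong-All (peel-positive α 0<α) (λ {(x , α′)} 0<α′ →
         ∑-cong-All (peel-positive β 0<β) (λ {(y , β′)} 0<β′ →
           cong (δ (x + y ≟ᵇ suc n)) (productCoeff-count α′ β′ e 0<α′ 0<β′))) ⟩
  ∑ (peel α) (λ (x , α′) → ∑ (peel β) λ (y , β′) →
    δ (x + y ≟ᵇ suc n) (count right (starts α′) (starts β′) (starts (flatten e))))
    ≡⟨ count-starts-∷ α β n (flatten e) 0<α 0<β ⟨
  count right (starts α) (starts β) (starts (flatten (suc n ∷ e))) ∎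
  where open ≡-Reasoning

infix 4 _≟ˡ_
_≟ˡ_ : (α β : List ℕ) → Dec (α ≡ β)
_≟ˡ_ = List.≡-dec ℕ._≟_

flatten-positive : (e : Vec ℕ m) → Positive (flatten e)
flatten-positive []          = []
flatten-positive (zero  ∷ e) = flatten-positive e
flatten-positive (suc n ∷ e) = s≤s z≤n ∷ flatten-positive e

flatten-fromList : ∀ γ → Positive γ → flatten (Vec.fromList γ) ≡ γ
flatten-fromList []          []            = refl
flatten-fromList (suc n ∷ γ) (s≤s _ ∷ 0<γ) = cong (suc n ∷_) (flatten-fromList γ 0<γ)

δ-∧ : ∀ b c z → δ b (δ c z) ≡ δ (b ∧ c) z
δ-∧ true  c z = refl
δ-∧ false c z = refl

-- Each monomial thus lies in exactly one `M_γ`; both the existence and the uniqueness of expansions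
-- rest on this.
coeffM-flatten : ∀ γ → Positive γ → (e : Vec ℕ m) →
                 coeffM γ e ≡ δ (does (γ ≟ˡ flatten e)) 1ℤ
coeffM-flatten []          0<γ           []          = refl
coeffM-flatten (g ∷ γ)     0<γ           []          = refl
coeffM-flatten []          0<γ           (zero  ∷ e) = trans (coeffM-[] 0 e) (coeffM-flatten [] 0<γ e)
coeffM-flatten []          0<γ           (suc n ∷ e) = coeffM-[] (suc n) e
coeffM-flatten (suc g ∷ γ) 0<γ@(s≤s _ ∷ _) (zero  ∷ e) =
  trans (coeffM-∷ (suc g) γ 0 e) (trans (ℤ.+-identityˡ _) (coeffM-flatten (suc g ∷ γ) 0<γ e))
coeffM-flatten (suc g ∷ γ) (0<g ∷ 0<γ)   (suc n ∷ e) = begin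
  coeffM (suc g ∷ γ) (suc n ∷ e)
    ≡⟨ coeffM-∷ (suc g) γ (suc n) e ⟩
  δ (g + 0 ≟ᵇ n) (coeffM γ e) ℤ.+ 0ℤ
    ≡⟨ ℤ.+-identityʳ _ ⟩
  δ (g + 0 ≟ᵇ n) (coeffM γ e)
    ≡⟨ cong₂ (λ g z → δ (g ≟ᵇ n) z) (ℕ.+-identityʳ g) (coeffM-flatten γ 0<γ e) ⟩
  δ (g ≟ᵇ n) (δ (does (γ ≟ˡ flatten e)) 1ℤ)
    ≡⟨ δ-∧ (g ≟ᵇ n) _ 1ℤ ⟩
  δ (does (suc g ∷ γ ≟ˡ suc n ∷ flatten e)) 1ℤ ∎
  where open ≡-Reasoning

-- Subsets and compositions

replicate-++-∷ : ∀ k (x : X) xs → replicate k x ++ x ∷ xs ≡ x ∷ replicate k x ++ xs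
replicate-++-∷ zero    x xs = refl
replicate-++-∷ (suc k) x xs = cong (x ∷_) (replicate-++-∷ k x xs)

-- Here `a` is the last cut found and `i` the next candidate. The `i ∸ suc a` bits `false` record
-- the candidates after `a` that were rejected.
starts-gaps : ∀ n a i (J : Subset m) → a < i → i + m ≡ n →
  starts (gaps n a (elementsFrom i J)) ≡ true ∷ replicate (i ∸ suc a) false ++ Vec.toList J
starts-gaps n a i [] a<i eq = cong (λ k → true ∷ replicate k false ++ []) (trans
  (ℕ.pred[m∸n]≡m∸[1+n] n a) (cong (_∸ suc a) (trans (sym eq) (ℕ.+-identityʳ i))))
starts-gaps {suc m} n a i (inside ∷ J) a<i eq = cong₂ (λ k L → true ∷ replicate k false ++ L)
  (ℕ.pred[m∸n]≡m∸[1+n] i a)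
  (trans (starts-gaps n i (suc i) J ℕ.≤-refl (trans (sym (ℕ.+-suc i m)) eq))
    (cong (λ k → true ∷ replicate k false ++ Vec.toList J) (ℕ.n∸n≡0 i)))
starts-gaps {suc m} n a i (outside ∷ J) a<i eq = begin
  starts (gaps n a (elementsFrom (suc i) J))
    ≡⟨ starts-gaps n a (suc i) J (ℕ.m<n⇒m<1+n a<i) (trans (sym (ℕ.+-suc i m)) eq) ⟩
  true ∷ replicate (i ∸ a) false ++ Vec.toList J
    ≡⟨ cong (λ k → true ∷ replicate k false ++ Vec.toList J) (sym (ℕ.+-∸-assoc 1 a<i)) ⟨
  true ∷ false ∷ replicate (i ∸ suc a) false ++ Vec.toList J
    ≡⟨ cong (true ∷_) (replicate-++-∷ (i ∸ suc a) false (Vec.toList J)) ⟨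
  true ∷ replicate (i ∸ suc a) false ++ false ∷ Vec.toList J ∎
  where open ≡-Reasoning

starts-composition : ∀ n (J : 𝒬 (suc n)) → starts (composition (suc n) J) ≡ true ∷ Vec.toList J
starts-composition n J = starts-gaps (suc n) 0 1 J ℕ.≤-refl refl

-- A nonempty `starts` begins with `true`, so the length of the initial run of `false` can be read
-- off.
replicate-starts-injective : ∀ a b α β →
  replicate a false ++ starts α ≡ replicate b false ++ starts β → a ≡ b × starts α ≡ starts β
replicate-starts-injective zero    zero    α       β       eq = refl , eq
replicate-starts-injective zero    (suc b) []      β       ()
replicate-starts-injective zero    (suc b) (x ∷ α) β       ()
replicate-starts-injective (suc a) zero    α       []      ()
replicate-starts-injective (suc a) zero    α       (y ∷ β) ()
replicate-starts-injective (suc a) (suc b) α       β       eq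
  with refl , eq′ ← replicate-starts-injective a b α β (List.∷-injectiveʳ eq) = refl , eq′

starts-injective : ∀ α β → Positive α → Positive β → starts α ≡ starts β → α ≡ β
starts-injective []          []          _             _             eq = refl
starts-injective (suc a ∷ α) (suc b ∷ β) (s≤s _ ∷ 0<α) (s≤s _ ∷ 0<β) eq
  with refl , eq′ ← replicate-starts-injective a b α β (List.∷-injectiveʳ eq)
  = cong (suc a ∷_) (starts-injective α β 0<α 0<β eq′)

length-starts : ∀ α → Positive α → length (starts α) ≡ sum α
length-starts []          []            = refl
length-starts (suc a ∷ α) (s≤s _ ∷ 0<α) = cong suc (trans
  (List.length-++ (replicate a false))
  (cong₂ _+_ (List.length-replicate a) (length-starts α 0<α)))

toList-injective : (xs ys : Vec X n) → Vec.toList xs ≡ Vec.toList ys → xs ≡ ys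
toList-injective xs ys eq = trans (sym (Vec.cast-is-id refl xs)) (Vec.toList-injective refl xs ys eq)

composition-injective : ∀ n (J J′ : 𝒬 (suc n)) → composition (suc n) J ≡ composition (suc n) J′ → J ≡ J′
composition-injective n J J′ eq = toList-injective J J′ (List.∷-injectiveʳ
  (trans (sym (starts-composition n J)) (trans (cong starts eq) (starts-composition n J′))))

toList-surjective : ∀ (xs : List X) → length xs ≡ n → ∃ λ (v : Vec X n) → Vec.toList v ≡ xs
toList-surjective xs refl = Vec.fromList xs , Vec.toList∘fromList xs

composition-surjective : ∀ n γ → Positive γ → sum γ ≡ suc n → ∃ λ R → composition (suc n) R ≡ γ
composition-surjective n (suc a ∷ γ) 0<γ@(s≤s _ ∷ _) eq
  -- `R` is `starts (suc a ∷ γ)` without its leading `true`.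
  with R , eq′ ← toList-surjective (replicate a false ++ starts γ)
                   (ℕ.suc-injective (trans (length-starts (suc a ∷ γ) 0<γ) eq))
  = R , starts-injective _ (suc a ∷ γ) (composition-positive (suc n) R) 0<γ
          (trans (starts-composition n R) (cong (true ∷_) eq′))

-- Expansions in the monomial quasi-symmetric functions

∑-zero : {f : X → ℤ} (xs : List X) → (∀ x → f x ≡ 0ℤ) → ∑ xs f ≡ 0ℤ
∑-zero xs f≡0 = trans (∑-cong xs f≡0) (∑-0 xs)

∑-subsets-suc : (f : Subset (suc m) → ℤ) → ∑ (subsets (suc m)) f ≡
                ∑ (subsets m) (f ∘ (outside ∷_)) ℤ.+ ∑ (subsets m) (f ∘ (inside ∷_))
∑-subsets-suc {m} f = trans (∑-cartesianProductWith _∷_ (outside ∷ inside ∷ []) (subsets m) f)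
  (cong (λ z → ∑ (subsets m) (f ∘ (outside ∷_)) ℤ.+ z) (ℤ.+-identityʳ _))

∑-subsets-point : (R : Subset m) (f : Subset m → ℤ) → (∀ S → S ≢ R → f S ≡ 0ℤ) →
                  ∑ (subsets m) f ≡ f R
∑-subsets-point []            f f≡0 = ℤ.+-identityʳ (f [])
∑-subsets-point {suc m} (outside ∷ R) f f≡0 = trans (∑-subsets-suc f) (trans
  (cong₂ ℤ._+_
    (∑-subsets-point R (f ∘ (outside ∷_)) (λ S S≢R → f≡0 _ (S≢R ∘ Vec.∷-injectiveʳ)))
    (∑-zero (subsets m) (λ S → f≡0 (inside ∷ S) λ ())))
  (ℤ.+-identityʳ _))
∑-subsets-point {suc m} (inside ∷ R) f f≡0 = trans (∑-subsets-suc f) (trans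
  (cong₂ ℤ._+_
    (∑-zero (subsets m) (λ S → f≡0 (outside ∷ S) λ ()))
    (∑-subsets-point R (f ∘ (inside ∷_)) (λ S S≢R → f≡0 _ (S≢R ∘ Vec.∷-injectiveʳ))))
  (ℤ.+-identityˡ _))

coeff-combination : ∀ n (d : 𝒬 n → ℤ) (e : Vec ℕ m) → coeff (combination n d) e ≡
  ∑ (subsets (ℕ.pred n)) (λ R → d R ℤ.* δ (does (composition n R ≟ˡ flatten e)) 1ℤ)
coeff-combination n d e = go (subsets (ℕ.pred n))
  where
  go : ∀ Rs → coeff (List.foldr _⊕_ 𝟘 (List.map (λ R → d R • M n R) Rs)) e ≡
              ∑ Rs (λ R → d R ℤ.* δ (does (composition n R ≟ˡ flatten e)) 1ℤ)
  go []       = refl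
  go (R ∷ Rs) = cong₂ ℤ._+_
    (cong (d R ℤ.*_) (coeffM-flatten (composition n R) (composition-positive n R) e)) (go Rs)

*-δ-false : ∀ {P : Set} (P? : Dec P) z → ¬ P → z ℤ.* δ (does P?) 1ℤ ≡ 0ℤ
*-δ-false P? z ¬p rewrite dec-false P? ¬p = ℤ.*-zeroʳ z

-- By injectivity of `composition` only the summand of `R` survives at `e`, so evaluation at such a
-- monomial extracts `d R`.
coeff-combination-composition : ∀ n (d : 𝒬 (suc n) → ℤ) (R : 𝒬 (suc n)) (e : Vec ℕ m) →
  composition (suc n) R ≡ flatten e → coeff (combination (suc n) d) e ≡ d R
coeff-combination-composition n d R e eq = begin
  coeff (combination (suc n) d) e
    ≡⟨ coeff-combination (suc n) d e ⟩
  ∑ (subsets n) (λ S → d S ℤ.* δ (does (composition (suc n) S ≟ˡ flatten e)) 1ℤ)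
    ≡⟨ ∑-subsets-point R _ (λ S S≢R → *-δ-false (_ ≟ˡ _) (d S)
         (λ eq′ → S≢R (composition-injective n S R (trans eq′ (sym eq))))) ⟩
  d R ℤ.* δ (does (composition (suc n) R ≟ˡ flatten e)) 1ℤ
    ≡⟨ cong (λ b → d R ℤ.* δ b 1ℤ) (dec-true (_ ≟ˡ _) eq) ⟩
  d R ℤ.* 1ℤ
    ≡⟨ ℤ.*-identityʳ (d R) ⟩
  d R ∎
  where open ≡-Reasoning

coeff-combination-degree : ∀ n (d : 𝒬 n → ℤ) (e : Vec ℕ m) →
  sum (flatten e) ≢ n → coeff (combination n d) e ≡ 0ℤ
coeff-combination-degree n d e sum≢n = trans (coeff-combination n d e)
  (∑-zero (subsets (ℕ.pred n)) λ R → *-δ-false (composition n R ≟ˡ flatten e) (d R)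
    (λ eq → sum≢n (trans (cong sum (sym eq)) (composition-sum n R))))

-- Every letter uses one bit of `R` and one of `J` or `K`. This handles the monomials whose degree
-- differs from that of the product.
count-length : ∀ c J K R → length R ≢ length J + length K → count c J K R ≡ 0ℤ
countLeft-length : ∀ c J K r R → suc (length R) ≢ length J + length K → countLeft c J K r R ≡ 0ℤ
countRight-length : ∀ c J K r R → suc (length R) ≢ length J + length K → countRight c J K r R ≡ 0ℤ
count-length c []      []      []      neq = contradiction refl neq
count-length c []      (_ ∷ _) []      neq = refl
count-length c (_ ∷ _) _       []      neq = refl
count-length c J       K       (r ∷ R) neq =
  cong₂ ℤ._+_ (countLeft-length c J K r R neq) (countRight-length c J K r R neq)
countLeft-length c []      K r R neq = refl
countLeft-length c (j ∷ J) K r R neq =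
  trans (cong (δ (leftOK c j r)) (count-length left J K R (neq ∘ cong suc))) (δ-0 (leftOK c j r))
countRight-length c J []      r R neq = refl
countRight-length c J (k ∷ K) r R neq =
  trans (cong (δ (rightOK c k r)) (count-length right J K R
    (λ eq → neq (trans (cong suc eq) (sym (ℕ.+-suc (length J) (length K)))))))
  (δ-0 (rightOK c k r))

module _ {p q} (J : 𝒬 (suc p)) (K : 𝒬 (suc q)) where

  private
    P = suc p
    Q = suc q

  countSets : 𝒬 (P + Q) → ℤ
  countSets R = count right (true ∷ Vec.toList J) (true ∷ Vec.toList K) (true ∷ Vec.toList R)

  coeff-product : (e : Vec ℕ m) → coeff (M P J ⊛ M Q K) e ≡
    count right (true ∷ Vec.toList J) (true ∷ Vec.toList K) (starts (flatten e))
  coeff-product e = trans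
    (productCoeff-count _ _ e (composition-positive P J) (composition-positive Q K))
    (cong₂ (λ A B → count right A B (starts (flatten e)))
      (starts-composition p J) (starts-composition q K))

  coeff-product-composition : ∀ R (e : Vec ℕ m) → composition (P + Q) R ≡ flatten e →
    coeff (M P J ⊛ M Q K) e ≡ countSets R
  coeff-product-composition R e eq = trans (coeff-product e)
    (cong (count right _ _) (trans (cong starts (sym eq)) (starts-composition (p + Q) R)))

  product-isCoefficient : ∀ R → IsCoefficientOfM (P + Q) R (M P J ⊛ M Q K) (countSets R)
  product-isCoefficient R = record
    { expansion = countSets , expand
    ; unique    = λ d eq → trans
        (sym (coeff-combination-composition (p + Q) d R γ (sym flatten-γ)))
        (trans (sym (eq γ)) (coeff-product-composition R γ (sym flatten-γ)))
    }
    where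
    -- The exponents are the parts of `R` themselves, so evaluation at this monomial isolates the
    -- coefficient of `M_R`.
    γ = Vec.fromList (composition (P + Q) R)
    flatten-γ = flatten-fromList (composition (P + Q) R) (composition-positive (P + Q) R)
    expand : M P J ⊛ M Q K ≋ combination (P + Q) countSets
    -- In degree `P + Q`, `flatten e` is the composition of some `S` and both sides equal
    -- `countSets S`; in any other degree both vanish.
    expand e with sum (flatten e) ℕ.≟ P + Q
    ... | yes eq with S , eq′ ← composition-surjective (p + Q) (flatten e) (flatten-positive e) eq =
      trans (coeff-product-composition S e eq′)
            (sym (coeff-combination-composition (p + Q) countSets S e eq′))
    ... | no neq = trans
      (trans (coeff-product e) (count-length right _ _ (starts (flatten e)) λ eq →
        neq (trans (sym (length-starts (flatten e) (flatten-positive e))) (trans eq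
          (cong₂ (λ a b → suc a + suc b) (Vec.length-toList J) (Vec.length-toList K))))))
      (sym (coeff-combination-degree (P + Q) countSets e neq))

-- Shuffles as words

-- The length is a separate index, although it always equals `p + q`; prepending a right letter then
-- needs no conversion along `+-suc`.
data Word : ℕ → ℕ → ℕ → Set where
  ε   : Word 0 0 0
  L∷_ : Word p q n → Word (suc p) q (suc n)
  R∷_ : Word p q n → Word p (suc q) (suc n)

-- The shuffle itself, with its domain split into the first `p` and the last `q` arguments; `index`
-- is the inverse.
position : Word p q n → Fin p ⊎ Fin q → Fin n
position (L∷ w) (inj₁ zero)    = zero
position (L∷ w) (inj₁ (suc i)) = suc (position w (inj₁ i))
position (L∷ w) (inj₂ j)       = suc (position w (inj₂ j))
position (R∷ w) (inj₁ i)       = suc (position w (inj₁ i))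
position (R∷ w) (inj₂ zero)    = zero
position (R∷ w) (inj₂ (suc j)) = suc (position w (inj₂ j))

index : Word p q n → Fin n → Fin p ⊎ Fin q
index (L∷ w) zero    = inj₁ zero
index (L∷ w) (suc k) = Sum.map₁ suc (index w k)
index (R∷ w) zero    = inj₂ zero
index (R∷ w) (suc k) = Sum.map₂ suc (index w k)

position-L∷ : (w : Word p q n) (x : Fin p ⊎ Fin q) →
              position (L∷ w) (Sum.map₁ suc x) ≡ suc (position w x)
position-L∷ w (inj₁ i) = refl
position-L∷ w (inj₂ j) = refl

position-R∷ : (w : Word p q n) (x : Fin p ⊎ Fin q) →
              position (R∷ w) (Sum.map₂ suc x) ≡ suc (position w x)
position-R∷ w (inj₁ i) = refl
position-R∷ w (inj₂ j) = refl

position-index : (w : Word p q n) → ∀ k → position w (index w k) ≡ k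
position-index (L∷ w) zero    = refl
position-index (L∷ w) (suc k) = trans (position-L∷ w (index w k)) (cong suc (position-index w k))
position-index (R∷ w) zero    = refl
position-index (R∷ w) (suc k) = trans (position-R∷ w (index w k)) (cong suc (position-index w k))

index-position : (w : Word p q n) → ∀ x → index w (position w x) ≡ x
index-position (L∷ w) (inj₁ zero)    = refl
index-position (L∷ w) (inj₁ (suc i)) = cong (Sum.map₁ suc) (index-position w (inj₁ i))
index-position (L∷ w) (inj₂ j)       = cong (Sum.map₁ suc) (index-position w (inj₂ j))
index-position (R∷ w) (inj₁ i)       = cong (Sum.map₂ suc) (index-position w (inj₁ i))
index-position (R∷ w) (inj₂ zero)    = refl
index-position (R∷ w) (inj₂ (suc j)) = cong (Sum.map₂ suc) (index-position w (inj₂ j))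

position-mono₁ : (w : Word p q n) {i j : Fin p} → i Fin.< j →
                 position w (inj₁ i) Fin.< position w (inj₁ j)
position-mono₁ (L∷ w) {zero}  {suc j} i<j       = s≤s z≤n
position-mono₁ (L∷ w) {suc i} {suc j} (s≤s i<j) = s≤s (position-mono₁ w i<j)
position-mono₁ (R∷ w)                 i<j       = s≤s (position-mono₁ w i<j)

position-mono₂ : (w : Word p q n) {i j : Fin q} → i Fin.< j →
                 position w (inj₂ i) Fin.< position w (inj₂ j)
position-mono₂ (R∷ w) {zero}  {suc j} i<j       = s≤s z≤n
position-mono₂ (R∷ w) {suc i} {suc j} (s≤s i<j) = s≤s (position-mono₂ w i<j)
position-mono₂ (L∷ w)                 i<j       = s≤s (position-mono₂ w i<j)

position-injective : (w w′ : Word p q n) → (∀ x → position w x ≡ position w′ x) → w ≡ w′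
position-injective ε      ε       eq = refl
position-injective (L∷ w) (L∷ w′) eq = cong L∷_ (position-injective w w′ λ
  { (inj₁ i) → Fin.suc-injective (eq (inj₁ (suc i)))
  ; (inj₂ j) → Fin.suc-injective (eq (inj₂ j)) })
position-injective (L∷ w) (R∷ w′) eq = contradiction (eq (inj₁ zero)) λ ()
position-injective (R∷ w) (L∷ w′) eq = contradiction (eq (inj₂ zero)) λ ()
position-injective (R∷ w) (R∷ w′) eq = cong R∷_ (position-injective w w′ λ
  { (inj₁ i) → Fin.suc-injective (eq (inj₁ i))
  ; (inj₂ j) → Fin.suc-injective (eq (inj₂ (suc j))) })

toPerm : ∀ p q → Word p q (p + q) → Permutation′ (p + q)
toPerm p q w = Perm.permutation (position w ∘ splitAt p) (join p q ∘ index w)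
  (λ k → trans (cong (position w) (Fin.splitAt-join p q (index w k))) (position-index w k))
  (λ i → trans (cong (join p q) (index-position w (splitAt p i))) (Fin.join-splitAt p q i))

toPerm-injective : ∀ p q (w w′ : Word p q (p + q)) → toPerm p q w Perm.≈ toPerm p q w′ → w ≡ w′
toPerm-injective p q w w′ eq = position-injective w w′ λ x → begin
  position w x                        ≡⟨ cong (position w) (Fin.splitAt-join p q x) ⟨
  position w (splitAt p (join p q x)) ≡⟨ eq (join p q x) ⟩
  position w′ (splitAt p (join p q x)) ≡⟨ cong (position w′) (Fin.splitAt-join p q x) ⟩
  position w′ x                       ∎
  where open ≡-Reasoning

toPerm-shuffle : ∀ p q (w : Word p q (p + q)) (ζ : Permutation′ (p + q)) →
                 ζ Perm.≈ toPerm p q w → Shuffle p q ζ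
toPerm-shuffle p q w ζ eq =
  (λ i j i<j → subst₂ Fin._<_ (sym (at (inj₁ i))) (sym (at (inj₁ j))) (position-mono₁ w i<j)) ,
  (λ i j i<j → subst₂ Fin._<_ (sym (at (inj₂ i))) (sym (at (inj₂ j))) (position-mono₂ w i<j))
  where
  at : ∀ x → ζ ⟨$⟩ʳ join p q x ≡ position w x
  at x = trans (eq (join p q x)) (cong (position w) (Fin.splitAt-join p q x))

-- u and v list the positions of the two kinds of letters in increasing order; the
-- word occupies the positions c , … , N - 1.
record Interleaving (c N : ℕ) (u : Fin p → ℕ) (v : Fin q → ℕ) : Set where
  field
    mono₁    : ∀ i j → i Fin.< j → u i < u j
    mono₂    : ∀ i j → i Fin.< j → v i < v j
    disjoint : ∀ i j → u i ≢ v j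
    lower₁   : ∀ i → c ≤ u i
    lower₂   : ∀ j → c ≤ v j
    upper₁   : ∀ i → u i < N
    upper₂   : ∀ j → v j < N
    cover    : ∀ k → c ≤ k → k < N → (∃ λ i → u i ≡ k) ⊎ (∃ λ j → v j ≡ k)

swap : {u : Fin p → ℕ} {v : Fin q → ℕ} {c N : ℕ} → Interleaving c N u v → Interleaving c N v u
swap I = record
  { mono₁ = mono₂ ; mono₂ = mono₁ ; disjoint = λ i j → disjoint j i ∘ sym
  ; lower₁ = lower₂ ; lower₂ = lower₁ ; upper₁ = upper₂ ; upper₂ = upper₁
  ; cover = λ k c≤k k<N → Sum.swap (cover k c≤k k<N) }
  where open Interleaving I

interleaving-nonempty : {u : Fin (suc p) → ℕ} {v : Fin q → ℕ} {c N : ℕ} → Interleaving c N u v → c < N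
interleaving-nonempty I = ℕ.≤-<-trans (lower₁ zero) (upper₁ zero)
  where open Interleaving I

-- `u (suc i)` exceeds `u zero`, which is at least `c`. Hence a letter standing at `c` is the first
-- of its kind.
interleaving-minimum : {u : Fin (suc p) → ℕ} {v : Fin q → ℕ} {c N : ℕ} →
  Interleaving c N u v → ∀ i → u (suc i) ≢ c
interleaving-minimum I i refl = ℕ.<⇒≱ (mono₁ zero (suc i) (s≤s z≤n)) (lower₁ zero)
  where open Interleaving I

interleaving-tail : {u : Fin (suc p) → ℕ} {v : Fin q → ℕ} {c N : ℕ} →
  Interleaving c N u v → u zero ≡ c → Interleaving (suc c) N (u ∘ suc) v
interleaving-tail {u = u} I refl = record
  { mono₁    = λ i j i<j → mono₁ (suc i) (suc j) (s≤s i<j)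
  ; mono₂    = mono₂
  ; disjoint = disjoint ∘ suc
  ; lower₁   = λ i → mono₁ zero (suc i) (s≤s z≤n)
  ; lower₂   = λ j → ℕ.≤∧≢⇒< (lower₂ j) (disjoint zero j)
  ; upper₁   = upper₁ ∘ suc
  ; upper₂   = upper₂
  ; cover    = λ k c<k k<N → Sum.map₁ (tail c<k) (cover k (ℕ.<⇒≤ c<k) k<N)
  }
  where
  open Interleaving I
  tail : ∀ {k} → u zero < k → ∃ (λ i → u i ≡ k) → ∃ (λ i → u (suc i) ≡ k)
  tail c<k (zero  , refl) = contradiction c<k (ℕ.<-irrefl refl)
  tail c<k (suc i , eq)   = i , eq

-- `cover` names the letter at position `c`; it is the first of its kind, and removing it leaves an
-- interleaving of the positions from `suc c` on.
interleaving-word : ∀ n c N (u : Fin p → ℕ) (v : Fin q → ℕ) → c + n ≡ N → Interleaving c N u v →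
  ∃ λ (w : Word p q n) → ∀ x → c + toℕ (position w x) ≡ [ u , v ]′ x
interleaving-word {zero}  {zero}  zero c N u v eq I = ε , λ { (inj₁ ()) ; (inj₂ ()) }
interleaving-word {suc p} {q}     zero c N u v eq I =
  contradiction (trans (sym (ℕ.+-identityʳ c)) eq) (ℕ.<⇒≢ (interleaving-nonempty I))
interleaving-word {zero}  {suc q} zero c N u v eq I =
  contradiction (trans (sym (ℕ.+-identityʳ c)) eq) (ℕ.<⇒≢ (interleaving-nonempty (swap I)))
interleaving-word (suc n) c N u v eq I
  with Interleaving.cover I c ℕ.≤-refl (subst (c <_) eq (ℕ.m<m+n c (s≤s z≤n)))
interleaving-word {suc p} {q} (suc n) c N u v eq I | inj₁ (suc i , e) =
  contradiction e (interleaving-minimum I i)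
interleaving-word {p} {suc q} (suc n) c N u v eq I | inj₂ (suc j , e) =
  contradiction e (interleaving-minimum (swap I) j)
interleaving-word {suc p} {q} (suc n) c N u v eq I | inj₁ (zero , e)
  with w , at ← interleaving-word n (suc c) N (u ∘ suc) v (trans (sym (ℕ.+-suc c n)) eq)
                  (interleaving-tail I e)
  = L∷ w , λ
    { (inj₁ zero)    → trans (ℕ.+-identityʳ c) (sym e)
    ; (inj₁ (suc i)) → trans (ℕ.+-suc c _) (at (inj₁ i))
    ; (inj₂ j)       → trans (ℕ.+-suc c _) (at (inj₂ j)) }
interleaving-word {p} {suc q} (suc n) c N u v eq I | inj₂ (zero , e)
  with w , at ← interleaving-word n (suc c) N u (v ∘ suc) (trans (sym (ℕ.+-suc c n)) eq)
                  (swap (interleaving-tail (swap I) e))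
  = R∷ w , λ
    { (inj₁ i)       → trans (ℕ.+-suc c _) (at (inj₁ i))
    ; (inj₂ zero)    → trans (ℕ.+-identityʳ c) (sym e)
    ; (inj₂ (suc j)) → trans (ℕ.+-suc c _) (at (inj₂ j)) }

-- The values of `ζ` on the first `p` and the last `q` arguments form an interleaving: injectivity
-- makes them disjoint, surjectivity makes them cover.
shuffle-toPerm : ∀ p q (ζ : Permutation′ (p + q)) → Shuffle p q ζ →
                 ∃ λ (w : Word p q (p + q)) → ζ Perm.≈ toPerm p q w
shuffle-toPerm p q ζ (mono₁ , mono₂) = w , λ i →
  trans (cong (ζ ⟨$⟩ʳ_) (sym (Fin.join-splitAt p q i)))
    (Fin.toℕ-injective (sym (trans (at (splitAt p i)) (copair (splitAt p i)))))
  where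
  u : Fin p → ℕ
  u i = toℕ (ζ ⟨$⟩ʳ (i ↑ˡ q))
  v : Fin q → ℕ
  v j = toℕ (ζ ⟨$⟩ʳ (p ↑ʳ j))
  copair : ∀ x → [ u , v ]′ x ≡ toℕ (ζ ⟨$⟩ʳ join p q x)
  copair (inj₁ i) = refl
  copair (inj₂ j) = refl
  injective : ∀ {i j} → ζ ⟨$⟩ʳ i ≡ ζ ⟨$⟩ʳ j → i ≡ j
  injective e = trans (sym (Perm.inverseˡ ζ)) (trans (cong (ζ ⟨$⟩ˡ_) e) (Perm.inverseˡ ζ))
  disjoint : ∀ i j → u i ≢ v j
  disjoint i j e with () ← trans (sym (Fin.splitAt-↑ˡ p i q))
    (trans (cong (splitAt p) (injective (Fin.toℕ-injective e))) (Fin.splitAt-↑ʳ p q j))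
  cover : ∀ k → (∃ λ i → u i ≡ toℕ k) ⊎ (∃ λ j → v j ≡ toℕ k)
  cover k with splitAt p (ζ ⟨$⟩ˡ k) | Fin.join-splitAt p q (ζ ⟨$⟩ˡ k)
  ... | inj₁ i | e = inj₁ (i , cong toℕ (trans (cong (ζ ⟨$⟩ʳ_) e) (Perm.inverseʳ ζ)))
  ... | inj₂ j | e = inj₂ (j , cong toℕ (trans (cong (ζ ⟨$⟩ʳ_) e) (Perm.inverseʳ ζ)))
  word = interleaving-word (p + q) 0 (p + q) u v refl record
    { mono₁ = mono₁ ; mono₂ = mono₂ ; disjoint = disjoint
    ; lower₁ = λ _ → z≤n ; lower₂ = λ _ → z≤n
    ; upper₁ = λ i → Fin.toℕ<n _ ; upper₂ = λ j → Fin.toℕ<n _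
    ; cover = λ k _ k<N → subst (λ k → (∃ λ i → u i ≡ k) ⊎ (∃ λ j → v j ≡ k))
                            (Fin.toℕ-fromℕ< k<N) (cover (Fin.fromℕ< k<N))
    }
  w  = proj₁ word
  at = proj₂ word

-- Descents of a shuffled word

-- The entry before the list is passed as `a`. A large `a` makes the first bit `true`, in agreement
-- with `starts`.
descentList : ℕ → List ℕ → List Bool
descentList a []       = []
descentList a (x ∷ xs) = does (x ℕ.<? a) ∷ descentList x xs

-- The run `f` continues `s` by consecutive values and has no descents. Its last value still exceeds
-- `b`, which is all that `h` asks of the entry before `ys`.
descentList-ascending : ∀ b ys Z → (∀ t → b < t → descentList t ys ≡ Z) →
  ∀ a s (f : Fin a → ℕ) → (∀ i → f i ≡ suc s + toℕ i) → b < s →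
  descentList s (List.tabulate f ++ ys) ≡ replicate a false ++ Z
descentList-ascending b ys Z h zero    s f eq b<s = h s b<s
descentList-ascending b ys Z h (suc a) s f eq b<s = cong₂ _∷_
  (dec-false (f zero ℕ.<? s) (ℕ.<⇒≯ s<f))
  (descentList-ascending b ys Z h a (f zero) (f ∘ suc)
    (λ i → trans (eq (suc i)) (trans (ℕ.+-suc (suc s) (toℕ i))
      (cong (λ x → suc (x + toℕ i)) (sym f≡1+s))))
    (ℕ.<-trans b<s s<f))
  where
  f≡1+s : f zero ≡ suc s
  f≡1+s = trans (eq zero) (ℕ.+-identityʳ (suc s))
  s<f : s < f zero
  s<f = subst (s <_) (sym f≡1+s) ℕ.≤-refl

-- `stack` puts the larger values first, so descents occur exactly where blocks begin. The bound `N`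
-- varies because in the induction it is the last entry of the preceding block.
descentList-blocks : ∀ α → Positive α → ∀ N → sum α < N → descentList N (oneLine (blocks α)) ≡ starts α
descentList-blocks []          []            N _     = refl
descentList-blocks (suc a ∷ α) (s≤s _ ∷ 0<α) N sum<N =
  trans (cong (descentList N) (oneLine-stack (suc a) (blocks α))) (cong₂ _∷_
    (dec-true (suc (sum α + 0) ℕ.<? N)
      (ℕ.≤-<-trans (s≤s (subst (_≤ a + sum α) (sym (ℕ.+-identityʳ (sum α))) (ℕ.m≤n+m (sum α) a))) sum<N))
    (descentList-ascending (sum α) (oneLine (blocks α)) (starts α) (descentList-blocks α 0<α)
      a (suc (sum α + 0)) _ (λ i → cong suc (trans (ℕ.+-suc (sum α) (toℕ i))
        (cong (λ x → suc (x + toℕ i)) (sym (ℕ.+-identityʳ (sum α))))))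
      (s≤s (ℕ.m≤m+n (sum α) 0))))

descents : ℕ → Vec ℕ n → Subset n
descents a []       = []
descents a (x ∷ xs) = does (x ℕ.<? a) ∷ descents x xs

-- The shifts by `suc` arise because `oneLine` counts values from one and `value` from zero.
toList-descents-tabulate : ∀ N (f : Fin n → ℕ) →
  Vec.toList (descents N (tabulate f)) ≡ descentList (suc N) (List.tabulate (suc ∘ f))
toList-descents-tabulate {zero}  N f = refl
toList-descents-tabulate {suc n} N f =
  cong (does (f zero ℕ.<? N) ∷_) (toList-descents-tabulate (f zero) (f ∘ suc))

value : Permutation′ n → Fin n → ℕ
value x i = toℕ (x ⟨$⟩ʳ i)

descents-ζ : ∀ n (J : 𝒬 (suc n)) N → suc n ≤ N →
             descents N (tabulate (value (ζ[_] {suc n} J))) ≡ true ∷ J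
descents-ζ n J N n<N = toList-injective _ _ (begin
  Vec.toList (descents N (tabulate (value (ζ[_] {suc n} J))))
    ≡⟨ toList-descents-tabulate N (value (ζ[_] {suc n} J)) ⟩
  descentList (suc N) (oneLine (ζ[_] {suc n} J))
    ≡⟨ cong (descentList (suc N)) (oneLine-subst (composition-sum (suc n) J) (blocks α)) ⟩
  descentList (suc N) (oneLine (blocks α))
    ≡⟨ descentList-blocks α (composition-positive (suc n) J) (suc N)
         (s≤s (subst (_≤ N) (sym (composition-sum (suc n) J)) n<N)) ⟩
  starts α
    ≡⟨ starts-composition n J ⟩
  true ∷ Vec.toList J ∎)
  where
  open ≡-Reasoning
  α = composition (suc n) J

<?-shift : ∀ k x y → does (k + x ℕ.<? k + y) ≡ does (x ℕ.<? y)
<?-shift zero    x y = refl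
<?-shift (suc k) x y = <?-shift k x y

descents-shift : ∀ k N (f : Fin n → ℕ) →
  descents (k + N) (tabulate (λ i → k + f i)) ≡ descents N (tabulate f)
descents-shift {zero}  k N f = refl
descents-shift {suc n} k N f = cong₂ _∷_ (<?-shift k (f zero) N) (descents-shift k (f zero) (f ∘ suc))

descents-tabulate : ∀ N (f : Fin (suc n) → ℕ) → descents N (tabulate f) ≡
  does (f zero ℕ.<? N) ∷ tabulate (λ i → does (f (suc i) ℕ.<? f (inject₁ i)))
descents-tabulate {zero}  N f = refl
descents-tabulate {suc n} N f = cong (does (f zero ℕ.<? N) ∷_) (descents-tabulate (f zero) (f ∘ suc))

descents-Des : (x : Permutation′ (suc n)) → descents (suc n) (tabulate (value x)) ≡ true ∷ Des x
descents-Des {n} x = trans (descents-tabulate (suc n) (value x))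
  (cong (_∷ Des x) (dec-true (value x zero ℕ.<? suc n) (Fin.toℕ<n (x ⟨$⟩ʳ zero))))

-- Merging two words along a shuffle

merge : Word p q n → Vec X p → Vec X q → Vec X n
merge ε      us       vs       = []
merge (L∷ w) (u ∷ us) vs       = u ∷ merge w us vs
merge (R∷ w) us       (v ∷ vs) = v ∷ merge w us vs

lookup-merge : (w : Word p q n) (us : Vec X p) (vs : Vec X q) → ∀ k →
               lookup (merge w us vs) k ≡ [ lookup us , lookup vs ]′ (index w k)
lookup-merge (L∷ w) (u ∷ us) vs zero    = refl
lookup-merge (L∷ w) (u ∷ us) vs (suc k) with index w k | lookup-merge w us vs k
... | inj₁ i | eq = eq
... | inj₂ j | eq = eq
lookup-merge (R∷ w) us (v ∷ vs) zero    = refl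
lookup-merge (R∷ w) us (v ∷ vs) (suc k) with index w k | lookup-merge w us vs k
... | inj₁ i | eq = eq
... | inj₂ j | eq = eq

∷-⊆⁻ : ∀ {x y} {J K : Subset n} → (x ∷ J) ⊆ (y ∷ K) → x Bool.≤ y × J ⊆ K
∷-⊆⁻ {x = false}             h = Bool.≤-minimum _ , drop-∷-⊆ h
∷-⊆⁻ {x = true}  {y = true}  h = b≤b , drop-∷-⊆ h
∷-⊆⁻ {x = true}  {y = false} h = contradiction (h here) λ ()

∷-⊆⁺ : ∀ {x y} {J K : Subset n} → x Bool.≤ y → J ⊆ K → (x ∷ J) ⊆ (y ∷ K)
∷-⊆⁺ b≤b h = s⊆s h
∷-⊆⁺ f≤t h = out⊆ h

-- The condition for any admissible pair to exist: "right, left" is always a descent and so must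
-- meet a cut.
Feasible : Letter → Word p q n → Subset n → Set
Feasible c     ε      R       = ⊤
Feasible left  (L∷ w) (r ∷ R) = Feasible left w R
Feasible right (L∷ w) (r ∷ R) = true Bool.≤ r × Feasible left w R
Feasible c     (R∷ w) (r ∷ R) = Feasible right w R

-- With `maxʳ` this gives the greatest admissible pair: a letter following its own kind has its bit
-- bounded by `r`, and one following the other kind has a free bit, set to `true`.
maxˡ : Letter → Word p q n → Subset n → Subset p
maxˡ c     ε      R       = []
maxˡ left  (L∷ w) (r ∷ R) = r ∷ maxˡ left w R
maxˡ right (L∷ w) (r ∷ R) = true ∷ maxˡ left w R
maxˡ c     (R∷ w) (r ∷ R) = maxˡ right w R

maxʳ : Letter → Word p q n → Subset n → Subset q
maxʳ c     ε      R       = []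
maxʳ c     (L∷ w) (r ∷ R) = maxʳ left w R
maxʳ left  (R∷ w) (r ∷ R) = true ∷ maxʳ right w R
maxʳ right (R∷ w) (r ∷ R) = r ∷ maxʳ right w R

choose : ∀ {ℓ} {A : Set ℓ} → Letter → A → A → A
choose left  x y = x
choose right x y = y

-- a and b are the latest values read from us and vs; all values in us are below t, all in
-- vs at least t. Since b is compared with us only when c = right (and a with vs only when
-- c = left), taking c = right and b large covers the start of the word.
module _ {t : ℕ} where

  descents-merge⇒ : ∀ c (w : Word p q n) {a b us vs} R →
    VecAll.All (_< t) us → VecAll.All (t ≤_) vs → choose c (a < t) (t ≤ b) →
    descents (choose c a b) (merge w us vs) ⊆ R →
    Feasible c w R × descents a us ⊆ maxˡ c w R × descents b vs ⊆ maxʳ c w R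
  descents-merge⇒ c ε {us = []} {[]} [] us<t t≤vs bound h = tt , id , id
  descents-merge⇒ left (L∷ w) {us = u ∷ _} (r ∷ R) (u<t ∷ us<t) t≤vs a<t h
    with x≤r , h′ ← ∷-⊆⁻ h
    with F , hJ , hK ← descents-merge⇒ left w R us<t t≤vs u<t h′
    = F , ∷-⊆⁺ x≤r hJ , hK
  descents-merge⇒ right (L∷ w) {b = b} {us = u ∷ _} (r ∷ R) (u<t ∷ us<t) t≤vs t≤b h
    with x≤r , h′ ← ∷-⊆⁻ h
    with F , hJ , hK ← descents-merge⇒ left w R us<t t≤vs u<t h′
    -- Since `u < t ≤ b`, this is a descent, which forces `r` to be `true`.
    = (subst (Bool._≤ r) (dec-true (u ℕ.<? b) (ℕ.<-≤-trans u<t t≤b)) x≤r , F) ,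
      ∷-⊆⁺ (Bool.≤-maximum _) hJ , hK
  descents-merge⇒ left (R∷ w) {vs = v ∷ _} (r ∷ R) us<t (t≤v ∷ t≤vs) a<t h
    with F , hJ , hK ← descents-merge⇒ right w R us<t t≤vs t≤v (drop-∷-⊆ h)
    = F , hJ , ∷-⊆⁺ (Bool.≤-maximum _) hK
  descents-merge⇒ right (R∷ w) {vs = v ∷ _} (r ∷ R) us<t (t≤v ∷ t≤vs) t≤b h
    with x≤r , h′ ← ∷-⊆⁻ h
    with F , hJ , hK ← descents-merge⇒ right w R us<t t≤vs t≤v h′
    = F , hJ , ∷-⊆⁺ x≤r hK

  descents-merge⇐ : ∀ c (w : Word p q n) {a b us vs} R →
    VecAll.All (_< t) us → VecAll.All (t ≤_) vs → choose c (a < t) (t ≤ b) →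
    Feasible c w R → descents a us ⊆ maxˡ c w R → descents b vs ⊆ maxʳ c w R →
    descents (choose c a b) (merge w us vs) ⊆ R
  descents-merge⇐ c ε {us = []} {[]} [] us<t t≤vs bound F hJ hK = id
  descents-merge⇐ left (L∷ w) {us = u ∷ _} (r ∷ R) (u<t ∷ us<t) t≤vs a<t F hJ hK
    with x≤r , hJ′ ← ∷-⊆⁻ hJ
    = ∷-⊆⁺ x≤r (descents-merge⇐ left w R us<t t≤vs u<t F hJ′ hK)
  descents-merge⇐ right (L∷ w) {us = u ∷ _} (true ∷ R) (u<t ∷ us<t) t≤vs t≤b (b≤b , F) hJ hK
    = ∷-⊆⁺ (Bool.≤-maximum _) (descents-merge⇐ left w R us<t t≤vs u<t F (drop-∷-⊆ hJ) hK)
  descents-merge⇐ left (R∷ w) {a = a} {vs = v ∷ _} (r ∷ R) us<t (t≤v ∷ t≤vs) a<t F hJ hK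
    -- Since `a < t ≤ v`, this is an ascent and is allowed whatever `r` is.
    = ∷-⊆⁺ (subst (Bool._≤ r) (sym (dec-false (v ℕ.<? a) (ℕ.<⇒≯ (ℕ.<-≤-trans a<t t≤v))))
              (Bool.≤-minimum r))
        (descents-merge⇐ right w R us<t t≤vs t≤v F hJ (drop-∷-⊆ hK))
  descents-merge⇐ right (R∷ w) {vs = v ∷ _} (r ∷ R) us<t (t≤v ∷ t≤vs) t≤b F hJ hK
    with x≤r , hK′ ← ∷-⊆⁻ hK
    = ∷-⊆⁺ x≤r (descents-merge⇐ right w R us<t t≤vs t≤v F hJ hK′)

toPerm-inverse : ∀ p q (w : Word p q (p + q)) (ζ : Permutation′ (p + q)) → ζ Perm.≈ toPerm p q w →
                 ∀ k → splitAt p (ζ ⟨$⟩ˡ k) ≡ index w k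
toPerm-inverse p q w ζ ζ≈w k = trans (cong (splitAt p) ζ⁻¹k) (Fin.splitAt-join p q (index w k))
  where
  ζ⁻¹k : ζ ⟨$⟩ˡ k ≡ join p q (index w k)
  ζ⁻¹k = trans
    (cong (ζ ⟨$⟩ˡ_) (sym (trans (ζ≈w _) (trans
      (cong (position w) (Fin.splitAt-join p q (index w k))) (position-index w k)))))
    (Perm.inverseˡ ζ)

module _ {p′ q′} (w : Word (suc p′) (suc q′) (suc p′ + suc q′)) (ζ : Permutation′ (suc p′ + suc q′))
         (ζ≈w : ζ Perm.≈ toPerm (suc p′) (suc q′) w) where

  private
    P = suc p′
    Q = suc q′

  module _ (x : Permutation′ P) (y : Permutation′ Q) where

    lowWord : Vec ℕ P
    lowWord = tabulate (value x)

    highWord : Vec ℕ Q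
    highWord = tabulate (λ j → P + value y j)

    -- The inverse of `ζ` sends a position to the index of the letter standing there, so the values
    -- of `x` and the shifted values of `y` appear in the order of `w`.
    word-merge : tabulate (value ((x ⊗ y) · Perm.flip ζ)) ≡ merge w lowWord highWord
    word-merge = trans (Vec.tabulate-cong letter) (Vec.tabulate∘lookup _)
      where
      entry : ∀ i → toℕ (join P Q (Sum.map (x ⟨$⟩ʳ_) (y ⟨$⟩ʳ_) i)) ≡
              [ lookup lowWord , lookup highWord ]′ i
      entry (inj₁ i) = trans (Fin.toℕ-↑ˡ (x ⟨$⟩ʳ i) Q) (sym (Vec.lookup∘tabulate (value x) i))
      entry (inj₂ j) = trans (Fin.toℕ-↑ʳ P (y ⟨$⟩ʳ j))
        (sym (Vec.lookup∘tabulate (λ j → P + value y j) j))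
      letter : ∀ k → value ((x ⊗ y) · Perm.flip ζ) k ≡ lookup (merge w lowWord highWord) k
      letter k = trans
        (cong (λ i → toℕ (join P Q (Sum.map (x ⟨$⟩ʳ_) (y ⟨$⟩ʳ_) i))) (toPerm-inverse P Q w ζ ζ≈w k))
        (trans (entry (index w k)) (sym (lookup-merge w lowWord highWord k)))

    lowWord< : VecAll.All (_< P) lowWord
    lowWord< = VecAll.tabulate⁺ (λ i → Fin.toℕ<n (x ⟨$⟩ʳ i))

    ≤highWord : VecAll.All (P ≤_) highWord
    ≤highWord = VecAll.tabulate⁺ (λ j → ℕ.m≤m+n P (toℕ (y ⟨$⟩ʳ j)))

  module _ (J : 𝒬 P) (K : 𝒬 Q) (R : 𝒬 (P + Q)) where

    private
      x = ζ[_] {P} J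
      y = ζ[_] {Q} K

    descents-r : descents (P + Q) (merge w (lowWord x y) (highWord x y)) ≡ true ∷ r {P} {Q} ζ J K
    descents-r = trans (cong (descents (P + Q)) (sym (word-merge x y)))
                       (descents-Des ((x ⊗ y) · Perm.flip ζ))

    descents-low : descents P (lowWord x y) ≡ true ∷ J
    descents-low = descents-ζ p′ J P ℕ.≤-refl

    descents-high : descents (P + Q) (highWord x y) ≡ true ∷ K
    descents-high = trans (descents-shift P Q (value y)) (descents-ζ q′ K Q ℕ.≤-refl)

    r⊆⇒ : r {P} {Q} ζ J K ⊆ R →
      Feasible right w (true ∷ R) × true ∷ J ⊆ maxˡ right w (true ∷ R) ×
      true ∷ K ⊆ maxʳ right w (true ∷ R)
    -- The threshold `P` separates low from high values. The starting values `P` and `P + Q` exceed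
    -- all low and all high ones respectively, which produces the leading `true` of each bit vector.
    r⊆⇒ h with F , hJ , hK ← descents-merge⇒ {t = P} right w {a = P} {b = P + Q} (true ∷ R)
      (lowWord< x y) (≤highWord x y) (ℕ.m≤m+n P Q)
      (subst (_⊆ true ∷ R) (sym descents-r) (s⊆s h))
      = F , subst (_⊆ maxˡ right w (true ∷ R)) descents-low hJ ,
            subst (_⊆ maxʳ right w (true ∷ R)) descents-high hK

    r⊆⇐ : Feasible right w (true ∷ R) → true ∷ J ⊆ maxˡ right w (true ∷ R) →
      true ∷ K ⊆ maxʳ right w (true ∷ R) → r {P} {Q} ζ J K ⊆ R
    r⊆⇐ F hJ hK = drop-∷-⊆ (subst (_⊆ true ∷ R) descents-r
      (descents-merge⇐ {t = P} right w {a = P} {b = P + Q} (true ∷ R)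
        (lowWord< x y) (≤highWord x y) (ℕ.m≤m+n P Q) F
        (subst (_⊆ maxˡ right w (true ∷ R)) (sym descents-low) hJ)
        (subst (_⊆ maxʳ right w (true ∷ R)) (sym descents-high) hK)))

-- Counting the matching words

Matches : Letter → Word p q n → Subset p → Subset q → Subset n → Set
Matches c w J K R = Feasible c w R × J ≡ maxˡ c w R × K ≡ maxʳ c w R

inside-∷-⊆ : {J : Subset n} {S : Subset (suc n)} → true ∷ J ⊆ S → ∃ λ S′ → S ≡ true ∷ S′
inside-∷-⊆ {S = true  ∷ S} h = S , refl
inside-∷-⊆ {S = false ∷ S} h with () ← proj₁ (∷-⊆⁻ h)

module _ {p q} (w : Word (suc p) (suc q) (suc p + suc q)) (ζ : Permutation′ (suc p + suc q))
         (ζ≈w : ζ Perm.≈ toPerm (suc p) (suc q) w)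
         (J : 𝒬 (suc p)) (K : 𝒬 (suc q)) (R : 𝒬 (suc p + suc q)) where

  greatest⇒matches : IsGreatest {suc p} {suc q} ζ R J K →
                     Matches right w (true ∷ J) (true ∷ K) (true ∷ R)
  greatest⇒matches (rJK⊆R , greatest)
    with F , hJ , hK ← r⊆⇒ w ζ ζ≈w J K R rJK⊆R
    with J₀ , eqJ ← inside-∷-⊆ hJ | K₀ , eqK ← inside-∷-⊆ hK
    with J₀⊆J , K₀⊆K ← greatest J₀ K₀ (r⊆⇐ w ζ ζ≈w J₀ K₀ R F
                         (subst (true ∷ J₀ ⊆_) (sym eqJ) id) (subst (true ∷ K₀ ⊆_) (sym eqK) id))
    = F , ⊆-antisym hJ (subst (_⊆ true ∷ J) (sym eqJ) (s⊆s J₀⊆J))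
        , ⊆-antisym hK (subst (_⊆ true ∷ K) (sym eqK) (s⊆s K₀⊆K))

  matches⇒greatest : Matches right w (true ∷ J) (true ∷ K) (true ∷ R) →
                     IsGreatest {suc p} {suc q} ζ R J K
  matches⇒greatest (F , eqJ , eqK) =
    r⊆⇐ w ζ ζ≈w J K R F (subst (true ∷ J ⊆_) eqJ id) (subst (true ∷ K ⊆_) eqK id) ,
    λ J′ K′ h → let _ , hJ , hK = r⊆⇒ w ζ ζ≈w J′ K′ R h in
      drop-∷-⊆ (subst (true ∷ J′ ⊆_) (sym eqJ) hJ) , drop-∷-⊆ (subst (true ∷ K′ ⊆_) (sym eqK) hK)

-- The recursion of `count`, collecting the words instead of counting them.
matching : Letter → Subset p → Subset q → Subset n → List (Word p q n)
matchingL : Letter → Subset p → Subset q → Bool → Subset n → List (Word p q (suc n))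
matchingR : Letter → Subset p → Subset q → Bool → Subset n → List (Word p q (suc n))
matching c J       K       (r ∷ R) = matchingL c J K r R ++ matchingR c J K r R
matching c []      []      []      = ε ∷ []
matching c []      (_ ∷ _) []      = []
matching c (_ ∷ _) _       []      = []
matchingL c []      K r R = []
matchingL c (j ∷ J) K r R = if leftOK c j r then List.map L∷_ (matching left J K R) else []
matchingR c J []      r R = []
matchingR c J (k ∷ K) r R = if rightOK c k r then List.map R∷_ (matching right J K R) else []

length-if : ∀ b (xs : List X) → + length (if b then xs else []) ≡ δ b (+ length xs)
length-if true  xs = refl
length-if false xs = refl

length-matching : ∀ c (J : Subset p) (K : Subset q) (R : Subset n) →
  + length (matching c J K R) ≡ count c (Vec.toList J) (Vec.toList K) (Vec.toList R)
length-matchingL : ∀ c (J : Subset p) (K : Subset q) r (R : Subset n) →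
  + length (matchingL c J K r R) ≡ countLeft c (Vec.toList J) (Vec.toList K) r (Vec.toList R)
length-matchingR : ∀ c (J : Subset p) (K : Subset q) r (R : Subset n) →
  + length (matchingR c J K r R) ≡ countRight c (Vec.toList J) (Vec.toList K) r (Vec.toList R)
length-matching c J       K       (r ∷ R) = trans
  (cong +_ (List.length-++ (matchingL c J K r R)))
  (cong₂ ℤ._+_ (length-matchingL c J K r R) (length-matchingR c J K r R))
length-matching c []      []      []      = refl
length-matching c []      (_ ∷ _) []      = refl
length-matching c (_ ∷ _) _       []      = refl
length-matchingL c []      K r R = refl
length-matchingL c (j ∷ J) K r R = trans (length-if (leftOK c j r) _) (cong (δ (leftOK c j r))
  (trans (cong +_ (List.length-map L∷_ (matching left J K R))) (length-matching left J K R)))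
length-matchingR c J []      r R = refl
length-matchingR c J (k ∷ K) r R = trans (length-if (rightOK c k r) _) (cong (δ (rightOK c k r))
  (trans (cong +_ (List.length-map R∷_ (matching right J K R))) (length-matching right J K R)))

∈-if⁻ : ∀ b {x : X} {xs} → x ∈ (if b then xs else []) → b ≡ true × x ∈ xs
∈-if⁻ true x∈ = refl , x∈

xor-refl : ∀ b → not (b xor b) ≡ true
xor-refl true  = refl
xor-refl false = refl

xnor-true⇒≡ : ∀ x y → not (x xor y) ≡ true → x ≡ y
xnor-true⇒≡ true  true  _ = refl
xnor-true⇒≡ false false _ = refl

matching-complete : ∀ c (w : Word p q n) R → Feasible c w R → w ∈ matching c (maxˡ c w R) (maxʳ c w R) R
matching-complete c     ε      []         F         = here refl
matching-complete left  (L∷ w) (r ∷ R)    F         rewrite xor-refl r =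
  ∈-++⁺ˡ (∈-map⁺ L∷_ (matching-complete left w R F))
matching-complete right (L∷ w) (true ∷ R) (b≤b , F) =
  ∈-++⁺ˡ (∈-map⁺ L∷_ (matching-complete left w R F))
matching-complete left  (R∷ w) (r ∷ R)    F         =
  ∈-++⁺ʳ (matchingL left (maxˡ right w R) _ r R) (∈-map⁺ R∷_ (matching-complete right w R F))
matching-complete right (R∷ w) (r ∷ R)    F         rewrite xor-refl r =
  ∈-++⁺ʳ (matchingL right (maxˡ right w R) _ r R) (∈-map⁺ R∷_ (matching-complete right w R F))

matchesL : ∀ c (w : Word p q n) {j r J K R} → leftOK c j r ≡ true →
           Matches left w J K R → Matches c (L∷ w) (j ∷ J) K (r ∷ R)
matchesL left  w {j} {r} ok (F , refl , refl) = F , cong (_∷ _) (xnor-true⇒≡ j r ok) , refl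
matchesL right w {true} {true} ok (F , refl , refl) = (b≤b , F) , refl , refl

matchesR : ∀ c (w : Word p q n) {k r J K R} → rightOK c k r ≡ true →
           Matches right w J K R → Matches c (R∷ w) J (k ∷ K) (r ∷ R)
matchesR left  w ok (F , refl , refl) = F , refl , cong (_∷ _) ok
matchesR right w {k} {r} ok (F , refl , refl) = F , refl , cong (_∷ _) (xnor-true⇒≡ k r ok)

matching-sound : ∀ c (J : Subset p) (K : Subset q) (R : Subset n) {w} →
                 w ∈ matching c J K R → Matches c w J K R
matching-sound c [] [] [] (here refl) = tt , refl , refl
matching-sound c J K (r ∷ R) w∈ with ∈-++⁻ (matchingL c J K r R) w∈
matching-sound c (j ∷ J) K (r ∷ R) w∈ | inj₁ w∈L
  with ok , w∈′ ← ∈-if⁻ (leftOK c j r) w∈L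
  with w , w∈″ , refl ← ∈-map⁻ L∷_ w∈′
  = matchesL c w ok (matching-sound left J K R w∈″)
matching-sound c J (k ∷ K) (r ∷ R) w∈ | inj₂ w∈R
  with ok , w∈′ ← ∈-if⁻ (rightOK c k r) w∈R
  with w , w∈″ , refl ← ∈-map⁻ R∷_ w∈′
  = matchesR c w ok (matching-sound right J K R w∈″)

if-unique : ∀ b {xs : List X} → Unique≡ xs → Unique≡ (if b then xs else [])
if-unique true  u = u
if-unique false u = []

matching-unique : ∀ c (J : Subset p) (K : Subset q) (R : Subset n) → Unique≡ (matching c J K R)
matchingL-unique : ∀ c (J : Subset p) (K : Subset q) r (R : Subset n) → Unique≡ (matchingL c J K r R)
matchingR-unique : ∀ c (J : Subset p) (K : Subset q) r (R : Subset n) → Unique≡ (matchingR c J K r R)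
matching-unique c J       K       (r ∷ R) =
  Unique≡.++⁺ (matchingL-unique c J K r R) (matchingR-unique c J K r R) (disjoint J K)
  where
  disjoint : ∀ {p q} (J : Subset p) (K : Subset q) {w} →
             w ∈ matchingL c J K r R × w ∈ matchingR c J K r R → ⊥
  disjoint (j ∷ J) (k ∷ K) (w∈L , w∈R)
    with _ , _ , refl ← ∈-map⁻ L∷_ (proj₂ (∈-if⁻ (leftOK c j r) w∈L))
    with _ , _ , () ← ∈-map⁻ R∷_ (proj₂ (∈-if⁻ (rightOK c k r) w∈R))
matching-unique c []      []      []      = [] ∷ []
matching-unique c []      (_ ∷ _) []      = []
matching-unique c (_ ∷ _) _       []      = []
matchingL-unique c []      K r R = []
matchingL-unique c (j ∷ J) K r R =
  if-unique (leftOK c j r) (Unique≡.map⁺ (λ { refl → refl }) (matching-unique left J K R))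
matchingR-unique c J []      r R = []
matchingR-unique c J (k ∷ K) r R =
  if-unique (rightOK c k r) (Unique≡.map⁺ (λ { refl → refl }) (matching-unique right J K R))

-- Comparing lists up to a setoid equality

module _ (S : Setoid 0ℓ 0ℓ) where
  open Setoid S using (Carrier; _≈_) renaming (sym to ≈-sym; trans to ≈-trans; reflexive to ≈-reflexive)

  lookup-injective : ∀ {xs} → Unique S xs → ∀ i j → List.lookup xs i ≈ List.lookup xs j → i ≡ j
  lookup-injective (x∉ ∷ u) zero    zero    eq = refl
  lookup-injective (x∉ ∷ u) zero    (suc j) eq = contradiction eq (All.lookup x∉ (∈-lookup j))
  lookup-injective (x∉ ∷ u) (suc i) zero    eq = contradiction (≈-sym eq) (All.lookup x∉ (∈-lookup i))
  lookup-injective (x∉ ∷ u) (suc i) (suc j) eq = cong suc (lookup-injective u i j eq)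

  -- Pigeonhole: sending each entry of `xs` to the place of an equivalent entry of `ys` is
  -- injective.
  unique⇒length≤ : ∀ {xs ys} → Unique S xs → (∀ {x} → x ∈ xs → Any (x ≈_) ys) → length xs ≤ length ys
  unique⇒length≤ {xs} {ys} u xs⊆ys = Fin.injective⇒≤ {f = f} λ {i} {j} eq →
    lookup-injective u i j (≈-trans (at i)
      (≈-trans (≈-reflexive (cong (List.lookup ys) eq)) (≈-sym (at j))))
    where
    f : Fin (length xs) → Fin (length ys)
    f i = Any.index (xs⊆ys (∈-lookup i))
    at : ∀ i → List.lookup xs i ≈ List.lookup ys (f i)
    at i = Any.lookup-index (xs⊆ys (∈-lookup i))

  -- Each list embeds into the other up to `≈`. `P` is asked of every `x ≈ f w`, since the
  -- representative of `f w` in `xs` may differ from `f w` itself.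
  length-filter : ∀ {W : Set} {P : Pred Carrier 0ℓ} (P? : Decidable P) {xs}
    (f : W → Carrier) {ws : List W} →
    Unique S xs → Unique≡ ws → (∀ {w w′} → f w ≈ f w′ → w ≡ w′) → (∀ w → Any (f w ≈_) xs) →
    (∀ {x w} → w ∈ ws → x ≈ f w → P x) → (∀ {x} → P x → ∃ λ w → w ∈ ws × x ≈ f w) →
    length (List.filter P? xs) ≡ length ws
  length-filter P? {xs} f {ws} xs! ws! f-injective xs-complete sound complete = trans
    (ℕ.≤-antisym
      (unique⇒length≤ (Unique.filter⁺ S P? xs!) λ x∈ →
        let _ , w∈ , x≈fw = complete (proj₂ (∈-filter⁻ P? {xs = xs} x∈))
        in lose (∈-map⁺ f w∈) x≈fw)
      (unique⇒length≤ (Unique.map⁺ (setoid _) S f-injective ws!) fw∈))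
    (List.length-map f ws)
    where
    fw∈ : ∀ {x} → x ∈ List.map f ws → Any (x ≈_) (List.filter P? xs)
    fw∈ x∈ with w , w∈ , refl ← ∈-map⁻ f x∈ with y , y∈ , fw≈y ← find (xs-complete w) =
      lose (∈-filter⁺ P? y∈ (sound w∈ (≈-sym fw≈y))) fw≈y

module _ {p q} (J : 𝒬 (suc p)) (K : 𝒬 (suc q)) (R : 𝒬 (suc p + suc q)) where

  matchingWords : List (Word (suc p) (suc q) (suc p + suc q))
  matchingWords = matching right (true ∷ J) (true ∷ K) (true ∷ R)

  MatchingShuffle : Pred (Permutation′ (suc p + suc q)) 0ℓ
  MatchingShuffle ζ = Shuffle (suc p) (suc q) ζ × IsGreatest {suc p} {suc q} ζ R J K

  word⇒shuffle : ∀ {ζ w} → w ∈ matchingWords → ζ Perm.≈ toPerm (suc p) (suc q) w → MatchingShuffle ζ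
  word⇒shuffle {ζ} {w} w∈ ζ≈w = toPerm-shuffle (suc p) (suc q) w ζ ζ≈w ,
    matches⇒greatest w ζ ζ≈w J K R (matching-sound right (true ∷ J) (true ∷ K) (true ∷ R) w∈)

  shuffle⇒word : ∀ {ζ} → MatchingShuffle ζ →
                 ∃ λ w → w ∈ matchingWords × ζ Perm.≈ toPerm (suc p) (suc q) w
  shuffle⇒word {ζ} (shuffle , greatest) =
    let w , ζ≈w       = shuffle-toPerm (suc p) (suc q) ζ shuffle
        F , eqJ , eqK = greatest⇒matches w ζ ζ≈w J K R greatest
    in w , subst₂ (λ J K → w ∈ matching right J K (true ∷ R)) (sym eqJ) (sym eqK)
             (matching-complete right w (true ∷ R) F) , ζ≈w

matchingShuffles-length : ∀ {p q} (J : 𝒬 (suc p)) (K : 𝒬 (suc q)) (R : 𝒬 (suc p + suc q)) →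
  numberOfMatchingShuffles {suc p} {suc q} J K R ≡ length (matchingWords J K R)
matchingShuffles-length {p} {q} J K R =
  length-filter (permSetoid (suc p + suc q))
    (λ ζ → shuffle? (suc p) (suc q) ζ ×-dec isGreatest? {suc p} {suc q} ζ R J K)
    (toPerm (suc p) (suc q))
    (permutations-unique (suc p + suc q))
    (matching-unique right (true ∷ J) (true ∷ K) (true ∷ R))
    (λ {w} {w′} → toPerm-injective (suc p) (suc q) w w′)
    (λ w → permutations-complete (suc p + suc q) (toPerm (suc p) (suc q) w))
    (λ {ζ} {w} → word⇒shuffle J K R {ζ} {w})
    (λ {ζ} → shuffle⇒word J K R {ζ})

mainTheorem14 : ∀ (p q : ℕ) → 1 ≤ p → 1 ≤ q →
    (J : 𝒬 p) (K : 𝒬 q) (R : 𝒬 (p + q)) →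
    IsCoefficientOfM (p + q) R (M p J ⊛ M q K) (+ numberOfMatchingShuffles {p} {q} J K R)
mainTheorem14 (suc p) (suc q) _ _ J K R =
  -- The length of the list of matching words turns the number of shuffles into `countSets J K R`.
  subst (IsCoefficientOfM (suc p + suc q) R (M (suc p) J ⊛ M (suc q) K))
    (sym (trans (cong +_ (matchingShuffles-length J K R))
                (length-matching right (true ∷ J) (true ∷ K) (true ∷ R))))
    (product-isCoefficient J K R)
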